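{- There exist positive constants $c_1$ and $c_2$ (not depending on $t$ or $q$) such that for all positive integers $t$ and $q$ with $q\ge 2$, there is $n_0=n_0(t,q)$ such that for all $n\ge n_0$, $$c_1\, t\,q^n/\sqrt{n} \le tw(H(t,q,n)) \le c_2\, t\,q^n/\sqrt{n}.$$
   Context: $H(t,q,n)$ (generalized Hamming graph) is the graph with vertex set $\{1,\dots,q\}^n$, two distinct vectors being adjacent iff their Hamming distance (number of coordinates in which they differ) is at most $t$. $tw(G)$ denotes the treewidth of $G$ (minimum over tree decompositions of maximum bag size minus 1). -}

module Defs where

open import Data.Empty using (⊥)
open import Data.Fin.Base using (Fin; zero)
open import Data.Fin.Properties using () renaming (_≟_ to _≟ᶠ_)
open import Data.Integer.Base using (+_)
open import Data.List.Base using (List; []; _∷_; [_]; _∷ʳ_; length; map; allFin; cartesianProductWith)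
open import Data.List.Extrema.Nat using (max)
open import Data.List.Membership.Propositional using (_∈_)
open import Data.List.Membership.Propositional.Properties using (∈-allFin; ∈-cartesianProductWith⁺)
open import Data.List.Relation.Unary.All using ([])
open import Data.List.Relation.Unary.AllPairs using ([]; _∷_)
open import Data.List.Relation.Unary.Any using (here)
open import Data.List.Relation.Unary.Linked using (Linked; _∷_)
open import Data.List.Relation.Unary.Unique.Propositional using (Unique)
open import Data.List.Relation.Unary.Unique.Propositional.Properties using (allFin⁺; cartesianProductWith⁺)
open import Data.Nat.Base using (ℕ; zero; suc; _∸_; _≤_; _<_; s≤s)
open import Data.Nat.Induction using (<-rec)
open import Data.Nat.Properties using (_≤?_; ≮⇒≥; ≤-antisym)
open import Data.Product.Base using (_×_; _,_; proj₁; proj₂; ∃-syntax)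
open import Data.Rational.Base as ℚ using (ℚ)
open import Data.Vec.Base using (Vec; []; _∷_; zip; count)
open import Data.Vec.Properties using (≡-dec; ∷-injective)
open import Relation.Binary.Construct.Closure.ReflexiveTransitive using (Star; ε)
open import Relation.Binary.Definitions using (Decidable; Symmetric; Irreflexive)
open import Relation.Binary.PropositionalEquality.Core using (_≡_; _≢_; refl; sym; cong; ≢-sym; subst)
open import Relation.Nullary using (¬_; ¬?; yes; no; contradiction)
open import Relation.Nullary.Decidable using (_×-dec_)

record Graph (V : Set) : Set₁ where
  field
    Adj        : V → V → Set
    adj?       : Decidable Adj
    adj-sym    : Symmetric Adj
    adj-irrefl : Irreflexive _≡_ Adj

module _ {V : Set} (G : Graph V) where
  open Graph G

  -- The subgraph induced by P is connected (or empty).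
  ConnectedOn : (V → Set) → Set
  ConnectedOn P = ∀ {u v} → P u → P v → Star (λ a b → Adj a b × P a × P b) u v

  -- x ∷ xs lists the vertices of a cycle in cyclic order, each once.
  IsCycle : V → List V → Set
  IsCycle x xs = 3 ≤ length (x ∷ xs) × Unique (x ∷ xs) × Linked Adj (x ∷ xs ∷ʳ x)

  record IsTree : Set where
    field
      root      : V      -- only says that a tree has at least one vertex
      connected : ∀ u v → Star Adj u v
      acyclic   : ∀ x xs → ¬ IsCycle x xs

-- Bags are finite sets of vertices, represented by duplicate-free lists, so
-- that the length of a bag is its cardinality.
record TreeDecomposition {V : Set} (G : Graph V) : Set₁ where
  open Graph G
  field
    size       : ℕ
    tree       : Graph (Fin size)
    isTree     : IsTree tree
    bag        : Fin size → List V
    bag-unique : ∀ i → Unique (bag i)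
    vertex-cov : ∀ v → ∃[ i ] v ∈ bag i
    edge-cov   : ∀ {u v} → Adj u v → ∃[ i ] (u ∈ bag i × v ∈ bag i)
    coherent   : ∀ v → ConnectedOn tree (λ i → v ∈ bag i)

  -- Truncated subtraction is harmless: if V is inhabited, some bag is nonempty.
  width : ℕ
  width = max 0 (map (λ i → length (bag i)) (allFin size)) ∸ 1

open TreeDecomposition using (width)

-- tw(G) = w.  The minimum is a relation because it need not be computable
-- for an arbitrary G; see treewidth-unique and H-treewidth-exists below.
IsTreewidth : {V : Set} → Graph V → ℕ → Set₁
IsTreewidth G w = (∃[ D ] width {G = G} D ≡ w) × (∀ (D : TreeDecomposition G) → w ≤ width D)

hamming : ∀ {q n} → Vec (Fin q) n → Vec (Fin q) n → ℕ
hamming u v = count (λ p → ¬? (proj₁ p ≟ᶠ proj₂ p)) (zip u v)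

hamming-sym : ∀ {q n} (u v : Vec (Fin q) n) → hamming u v ≡ hamming v u
hamming-sym []      []      = refl
hamming-sym (a ∷ u) (b ∷ v) with a ≟ᶠ b | b ≟ᶠ a
... | yes _   | yes _   = hamming-sym u v
... | no _    | no _    = cong suc (hamming-sym u v)
... | yes a≡b | no b≢a  = contradiction (sym a≡b) b≢a
... | no a≢b  | yes b≡a = contradiction (sym b≡a) a≢b

-- Fin q plays the role of {1,…,q}.
H : ∀ t q n → Graph (Vec (Fin q) n)
H t q n = record
  { Adj        = λ u v → u ≢ v × hamming u v ≤ t
  ; adj?       = λ u v → ¬? (≡-dec _≟ᶠ_ u v) ×-dec (hamming u v ≤? t)
  ; adj-sym    = λ {u} {v} (u≢v , d) → ≢-sym u≢v , subst (_≤ t) (hamming-sym u v) d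
  ; adj-irrefl = λ u≡v (u≢v , _) → u≢v u≡v
  }

ℕ→ℚ : ℕ → ℚ
ℕ→ℚ m = + m ℚ./ 1

-- For x, y ≥ 0 and n ≥ 1, the inequalities x/√n ≤ y and y ≤ x/√n between
-- real numbers, with √n cleared by squaring.  For n = 0 the first one says
-- x = 0, hence fails when x > 0.
infix 4 _/√_≤_ _≤_/√_

_/√_≤_ : ℚ → ℕ → ℚ → Set
x /√ n ≤ y = x ℚ.* x ℚ.≤ y ℚ.* y ℚ.* ℕ→ℚ n

_≤_/√_ : ℚ → ℚ → ℕ → Set
y ≤ x /√ n = y ℚ.* y ℚ.* ℕ→ℚ n ℚ.≤ x ℚ.* x

-- The following shows that IsTreewidth (H t q n) is satisfied by at most one w,
-- and (up to double negation) by at least one.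

treewidth-unique : ∀ {V} {G : Graph V} {w w′} → IsTreewidth G w → IsTreewidth G w′ → w ≡ w′
treewidth-unique ((D , refl) , lb) ((D′ , refl) , lb′) = ≤-antisym (lb D′) (lb′ D)

treewidth-exists : ∀ {V} {G : Graph V} → TreeDecomposition G → ¬ ¬ (∃[ w ] IsTreewidth G w)
treewidth-exists {G = G} D₀ none = <-rec NotAWidth step (width D₀) D₀ refl
  where
  NotAWidth : ℕ → Set₁
  NotAWidth k = ∀ (D : TreeDecomposition G) → width D ≡ k → ⊥

  step : ∀ k → (∀ {j} → j < k → NotAWidth j) → NotAWidth k
  step k smaller D eq = none (k , (D , eq) , λ D′ → ≮⇒≥ (λ D′<k → smaller D′<k D′ refl))

point : Graph (Fin 1)
point = record
  { Adj        = λ _ _ → ⊥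
  ; adj?       = λ _ _ → no λ ()
  ; adj-sym    = λ ()
  ; adj-irrefl = λ _ ()
  }

point-isTree : IsTree point
point-isTree = record
  { root      = zero
  ; connected = λ { zero zero → ε }
  ; acyclic   = λ { _ [] (s≤s () , _) ; _ (_ ∷ _) (_ , _ , () ∷ _) }
  }

vectors : ∀ q n → List (Vec (Fin q) n)
vectors q zero    = [ [] ]
vectors q (suc n) = cartesianProductWith _∷_ (allFin q) (vectors q n)

vectors-unique : ∀ q n → Unique (vectors q n)
vectors-unique q zero    = [] ∷ []
vectors-unique q (suc n) = cartesianProductWith⁺ _∷_ ∷-injective (allFin⁺ q) (vectors-unique q n)

∈-vectors : ∀ {q n} (v : Vec (Fin q) n) → v ∈ vectors q n
∈-vectors []      = here refl
∈-vectors (a ∷ v) = ∈-cartesianProductWith⁺ _∷_ (∈-allFin a) (∈-vectors v)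

H-treewidth-exists : ∀ t q n → ¬ ¬ (∃[ w ] IsTreewidth (H t q n) w)
H-treewidth-exists t q n = treewidth-exists record
  { size       = 1
  ; tree       = point
  ; isTree     = point-isTree
  ; bag        = λ _ → vectors q n
  ; bag-unique = λ _ → vectors-unique q n
  ; vertex-cov = λ v → zero , ∈-vectors v
  ; edge-cov   = λ {u} {v} _ → zero , ∈-vectors u , ∈-vectors v
  ; coherent   = λ { v {zero} {zero} _ _ → ε }
  }

{-# OPTIONS --safe #-}

-- Lower bound.  The vertex isoperimetric inequality of the Hamming graph with
-- t = 1, proved by induction on n over the sections of a set, says that a set A
-- has at least |A| |Aᶜ| / (4 √n qⁿ) outer neighbours.  Iterated t times, it shows
-- that at least t |A| |B| / (4 √n qⁿ) vertices lie outside A ∪ B whenever A and B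
-- are at distance more than t.  In a tree decomposition some bag separates two
-- sets of size at least qⁿ/4, unless some bag has more than qⁿ/12 vertices.
--
-- Upper bound.  Let the weight of a vector be the number of its coordinates that
-- lie in a fixed half of {1,…,q}.  The vectors of weight i, …, i + t form the i-th
-- bag of a path decomposition.  A set of given weight has O(qⁿ/√n) elements: on
-- one side of it about √n further weights occur at least half as often, and
-- together they account for at most qⁿ vectors.

module Submission where

open import Defs
open TreeDecomposition using (width)
open import Data.Bool.Base using (Bool; true; false; not; _∧_; _∨_; if_then_else_)
open import Data.Fin.Base as Fin using (Fin; toℕ; fromℕ<)
open import Data.Fin.Properties using (injective⇒≤; toℕ-injective; toℕ<n; toℕ-fromℕ<) renaming (_≟_ to _≟ᶠ_)
import Data.Integer.Base as ℤ
import Data.Integer.Properties as ℤ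
open import Data.List.Base using (List; []; _∷_; _++_; _∷ʳ_; length; map; filter; allFin; tabulate; lookup; cartesianProductWith)
open import Data.List.Extrema.Nat using (max; xs≤max; argmax-all)
open import Data.List.Membership.Propositional using (_∈_; _∉_; find; lose)
open import Data.List.Membership.Propositional.Properties using (∈-++⁺ˡ; ∈-++⁺ʳ; ∈-++⁻; ∈-allFin; ∈-lookup; ∈-map⁺; ∈-filter⁺; ∈-filter⁻)
open import Data.List.Properties using (length-++; filter-++)
open import Data.List.Relation.Unary.All as All using (All; []; _∷_)
open import Data.List.Relation.Unary.All.Properties using (¬Any⇒All¬; map⁺)
open import Data.List.Relation.Unary.AllPairs using ([]; _∷_)
open import Data.List.Relation.Unary.Any using (Any; here; there; any?)
open import Data.List.Relation.Unary.Any.Properties using (++⁻)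
open import Data.List.Relation.Unary.Linked using (Linked; [-]; _∷_)
open import Data.List.Relation.Unary.Unique.Propositional using (Unique)
open import Data.List.Relation.Unary.Unique.Propositional.Properties using (filter⁺)
open import Data.Nat.Base as ℕ using (ℕ; NonZero; _≡ᵇ_; ≢-nonZero; zero; suc; _+_; _*_; _∸_; _^_; _≤_; _<_; z≤n; s≤s)
open import Data.Nat.Properties
open import Data.Nat.Tactic.RingSolver using (solve-∀)
open import Data.Product.Base as Product using (_×_; _,_; proj₁; proj₂; ∃-syntax)
open import Data.Rational.Base as ℚ using (ℚ; 0ℚ; 1ℚ)
import Data.Rational.Properties as ℚ
open import Data.Rational.Solver using (module +-*-Solver)
import Data.Rational.Unnormalised.Base as ℚᵘ
import Data.Rational.Unnormalised.Properties as ℚᵘ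
open import Data.Sum.Base as Sum using (_⊎_; inj₁; inj₂; [_,_]′; map₁; map₂)
open import Data.Unit.Base using (⊤; tt)
open import Data.Vec.Base using (Vec; []; _∷_; replicate)
open import Data.Vec.Properties using (≡-dec)
open import Function.Base using (_∘_)
open import Relation.Binary.Construct.Closure.ReflexiveTransitive as Star using (Star; ε; _◅_)
open import Relation.Binary.PropositionalEquality
open import Relation.Nullary using (Dec; does; yes; no; ¬_; contradiction)
open import Relation.Nullary.Decidable using (_×-dec_; _⊎-dec_)
open import Relation.Unary using (Decidable)
open import Algebra.Properties.Semiring.Sum +-*-semiring
  using (sum; sum-cong-≗; ∑-distrib-+; *-distribˡ-sum)

-- Vertex isoperimetry in Hamming graphs

-- The product |A| |Aᶜ| is what makes the induction on n close. A section of A grows for two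
-- reasons: within its own copy of the smaller graph, and because a change of the first coordinate
-- carries the largest section, of size M, into every copy. The section products, summed and
-- multiplied by q, fall short of |A| |Aᶜ| by q² times the variance of the section sizes. This loss
-- is quadratic in the differences M - a, and the second kind of growth pays for it. The place of
-- 1/√n is taken by a ratio of double factorials, whose factor (2n+1)/(2n+2) from n to n + 1 is what
-- the comparison of the two kinds of growth yields; this keeps the induction within the natural
-- numbers. The condition t² ≤ n comes from the tree decomposition: a bag that holds a fixed
-- fraction of all vectors has order t qⁿ/√n or more only if t is at most of order √n.

sum-mono-≤ : ∀ {n} {f g : Fin n → ℕ} → (∀ i → f i ≤ g i) → sum f ≤ sum g
sum-mono-≤ {zero}  f≤g = z≤n
sum-mono-≤ {suc n} f≤g = +-mono-≤ (f≤g Fin.zero) (sum-mono-≤ (f≤g ∘ Fin.suc))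

sum-const : ∀ n c → sum {n} (λ _ → c) ≡ n * c
sum-const zero    c = refl
sum-const (suc n) c = cong (c +_) (sum-const n c)

bit : Bool → ℕ
bit b = if b then 1 else 0

-- Counting by the first coordinate makes the size of a set the sum of the sizes of its sections by
-- definition, as the inductions on n require. Inclusions are written as inequalities between
-- `bit`s.
card : ∀ {q n} → (Vec (Fin q) n → Bool) → ℕ
card {n = zero}  f = bit (f [])
card {n = suc n} f = sum (λ b → card (λ v → f (b ∷ v)))

card-mono : ∀ {q n} {f g : Vec (Fin q) n → Bool} → (∀ v → bit (f v) ≤ bit (g v)) → card f ≤ card g
card-mono {n = zero}  f≤g = f≤g []
card-mono {n = suc n} f≤g = sum-mono-≤ (λ b → card-mono (λ v → f≤g (b ∷ v)))

card-+ : ∀ {q n} {f g h k : Vec (Fin q) n → Bool} →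
         (∀ v → bit (f v) + bit (g v) ≡ bit (h v) + bit (k v)) → card f + card g ≡ card h + card k
card-+ {n = zero}  eq = eq []
card-+ {q} {suc n} {f} {g} {h} {k} eq =
  trans (sym (∑-distrib-+ (slices f) (slices g)))
  (trans (sum-cong-≗ (λ b → card-+ {f = λ v → f (b ∷ v)} {λ v → g (b ∷ v)}
                                   {λ v → h (b ∷ v)} {λ v → k (b ∷ v)} (λ v → eq (b ∷ v))))
         (∑-distrib-+ (slices h) (slices k)))
  where
  slices : (Vec (Fin q) (suc n) → Bool) → Fin q → ℕ
  slices f b = card (λ v → f (b ∷ v))

card-true : ∀ {q n} → card {q} {n} (λ _ → true) ≡ q ^ n
card-true {n = zero}  = refl
card-true {q} {suc n} = trans (sum-const q _) (cong (q *_) (card-true {q} {n}))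

card-false : ∀ {q n} → card {q} {n} (λ _ → false) ≡ 0
card-false {n = zero}  = refl
card-false {q} {suc n} =
  trans (sum-cong-≗ {q} (λ _ → card-false {q} {n})) (trans (sum-const q 0) (*-zeroʳ q))

card-not : ∀ {q n} (f : Vec (Fin q) n → Bool) → card f + card (not ∘ f) ≡ q ^ n
card-not {q} {n} f = begin
  card f + card (not ∘ f)                               ≡⟨ card-+ {f = f} {not ∘ f} (λ v → bit-not (f v)) ⟩
  card {q} {n} (λ _ → true) + card {q} {n} (λ _ → false) ≡⟨ cong₂ _+_ (card-true {q} {n}) (card-false {q} {n}) ⟩
  q ^ n + 0                                             ≡⟨ +-identityʳ _ ⟩
  q ^ n                                                 ∎
  where
  open ≡-Reasoning
  bit-not : ∀ b → bit b + bit (not b) ≡ 1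
  bit-not true  = refl
  bit-not false = refl

anyᶠ : ∀ {q} → (Fin q → Bool) → Bool
anyᶠ {zero}  f = false
anyᶠ {suc q} f = f Fin.zero ∨ anyᶠ (f ∘ Fin.suc)

-- The closed neighbourhood for Hamming distance 1. The two disjuncts, head kept and head changed,
-- are the two sources of growth of a section.
expand : ∀ {q n} → (Vec (Fin q) n → Bool) → Vec (Fin q) n → Bool
expand f []      = f []
expand f (b ∷ v) = expand (λ u → f (b ∷ u)) v ∨ anyᶠ (λ c → f (c ∷ v))

bit-∨ˡ : ∀ a b → bit a ≤ bit (a ∨ b)
bit-∨ˡ true  b = ≤-refl
bit-∨ˡ false b = z≤n

bit-∨ʳ : ∀ a b → bit b ≤ bit (a ∨ b)
bit-∨ʳ true  true  = ≤-refl
bit-∨ʳ true  false = z≤n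
bit-∨ʳ false b     = ≤-refl

bit-anyᶠ : ∀ {q} (f : Fin q → Bool) c → bit (f c) ≤ bit (anyᶠ f)
bit-anyᶠ f Fin.zero    = bit-∨ˡ (f Fin.zero) _
bit-anyᶠ f (Fin.suc c) = ≤-trans (bit-anyᶠ (f ∘ Fin.suc) c) (bit-∨ʳ (f Fin.zero) _)

f⊆expand : ∀ {q n} (f : Vec (Fin q) n → Bool) v → bit (f v) ≤ bit (expand f v)
f⊆expand f []      = ≤-refl
f⊆expand f (b ∷ v) =
  ≤-trans (f⊆expand (λ u → f (b ∷ u)) v) (bit-∨ˡ (expand (λ u → f (b ∷ u)) v) _)

-- odds n / evens n = (2n)! / (4ⁿ n!²), which is of the order of 1/√n.
odds evens : ℕ → ℕ
odds  zero    = 1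
odds  (suc n) = (2 * n + 1) * odds n
evens zero    = 1
evens (suc n) = (2 * n + 2) * evens n

odds≤evens : ∀ n → odds n ≤ evens n
odds≤evens zero    = ≤-refl
odds≤evens (suc n) = *-mono-≤ (+-monoʳ-≤ (2 * n) (s≤s z≤n)) (odds≤evens n)

-- As in Wallis' product, the step is (2n+1)(2n+3) + 1 = (2n+2)². This estimate drives the induction
-- in `isoperimetry`.
odds-upper : ∀ n → (2 * n + 1) * (odds n * odds n) ≤ evens n * evens n
odds-upper zero    = ≤-refl
odds-upper (suc n) = begin
  (2 * suc n + 1) * ((2 * n + 1) * p * ((2 * n + 1) * p)) ≡⟨ regroup n p ⟩
  (2 * n + 3) * (2 * n + 1) * ((2 * n + 1) * (p * p))     ≤⟨ *-monoʳ-≤ ((2 * n + 3) * (2 * n + 1)) (odds-upper n) ⟩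
  (2 * n + 3) * (2 * n + 1) * (e * e)                     ≤⟨ m≤m+n _ (e * e) ⟩
  (2 * n + 3) * (2 * n + 1) * (e * e) + e * e             ≡⟨ square n e ⟩
  (2 * n + 2) * e * ((2 * n + 2) * e)                     ∎
  where
  open ≤-Reasoning
  p = odds n
  e = evens n
  regroup : ∀ n p → (2 * suc n + 1) * ((2 * n + 1) * p * ((2 * n + 1) * p))
                  ≡ (2 * n + 3) * (2 * n + 1) * ((2 * n + 1) * (p * p))
  regroup = solve-∀
  square : ∀ n e → (2 * n + 3) * (2 * n + 1) * (e * e) + e * e ≡ (2 * n + 2) * e * ((2 * n + 2) * e)
  square = solve-∀

-- The step is 4(n+1)(n+2) + 1 = (2n+3)². It turns the ratio of `odds` and `evens` back into a
-- multiple of 1/√n at the end.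
odds-lower : ∀ n → evens (suc n) * evens (suc n) ≤ 4 * suc n * (odds (suc n) * odds (suc n))
odds-lower zero    = ≤-refl
odds-lower (suc n) = begin
  (2 * suc n + 2) * e * ((2 * suc n + 2) * e)                     ≡⟨ regroup n e ⟩
  (2 * n + 4) * (2 * n + 4) * (e * e)                             ≤⟨ *-monoʳ-≤ ((2 * n + 4) * (2 * n + 4)) (odds-lower n) ⟩
  (2 * n + 4) * (2 * n + 4) * (4 * suc n * (p * p))               ≤⟨ m≤m+n _ (4 * (n + 2) * (p * p)) ⟩
  (2 * n + 4) * (2 * n + 4) * (4 * suc n * (p * p)) + 4 * (n + 2) * (p * p) ≡⟨ square n p ⟩
  4 * suc (suc n) * ((2 * suc n + 1) * p * ((2 * suc n + 1) * p)) ∎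
  where
  open ≤-Reasoning
  p = odds (suc n)
  e = evens (suc n)
  regroup : ∀ n e → (2 * suc n + 2) * e * ((2 * suc n + 2) * e) ≡ (2 * n + 4) * (2 * n + 4) * (e * e)
  regroup = solve-∀
  square : ∀ n p → (2 * n + 4) * (2 * n + 4) * (4 * suc n * (p * p)) + 4 * (n + 2) * (p * p)
                 ≡ 4 * suc (suc n) * ((2 * suc n + 1) * p * ((2 * suc n + 1) * p))
  square = solve-∀

-- Applied with δ = M − a, where a is the size of a section and M the largest of
-- these sizes, with g = a a′, and with d the growth of the section.
section-growth : ∀ n P Q N δ d g .{{_ : NonZero P}} .{{_ : NonZero N}} →
                 P ≤ Q → (2 * n + 1) * (P * P) ≤ Q * Q → δ ≤ N → g ≤ N * N →
                 δ ≤ d → P * g ≤ 2 * Q * N * d →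
                 (2 * n + 1) * P * (δ * δ + g) ≤ 2 * (2 * n + 2) * Q * N * d
-- The two lower bounds for d are δ and Pg/(2QN). If the first dominates, both Pδ² and Pg are at
-- most QNδ. If the second does, δ is so small that (2n+1)δ² ≤ g, whence (2n+1)(δ² + g) ≤ (2n+2)g.
section-growth n P Q N δ d g P≤Q P²≤Q² δ≤N g≤N² δ≤d Pg≤d = [ small-g , large-g ]′ (≤-total (P * g) (Q * N * δ))
  where
  open ≤-Reasoning

  small-g : P * g ≤ Q * N * δ → (2 * n + 1) * P * (δ * δ + g) ≤ 2 * (2 * n + 2) * Q * N * d
  small-g Pg≤δ = begin
    (2 * n + 1) * P * (δ * δ + g)         ≡⟨ distribute (2 * n + 1) P δ g ⟩
    (2 * n + 1) * (P * δ * δ + P * g)     ≤⟨ *-monoʳ-≤ (2 * n + 1) (+-mono-≤ (*-monoˡ-≤ δ (*-mono-≤ P≤Q δ≤N)) Pg≤δ) ⟩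
    (2 * n + 1) * (Q * N * δ + Q * N * δ) ≤⟨ *-monoˡ-≤ (Q * N * δ + Q * N * δ) (+-monoʳ-≤ (2 * n) (s≤s z≤n)) ⟩
    (2 * n + 2) * (Q * N * δ + Q * N * δ) ≡⟨ double (2 * n + 2) Q N δ ⟩
    2 * (2 * n + 2) * Q * N * δ           ≤⟨ *-monoʳ-≤ (2 * (2 * n + 2) * Q * N) δ≤d ⟩
    2 * (2 * n + 2) * Q * N * d           ∎
    where
    distribute : ∀ k P δ g → k * P * (δ * δ + g) ≡ k * (P * δ * δ + P * g)
    distribute = solve-∀
    double : ∀ k Q N δ → k * (Q * N * δ + Q * N * δ) ≡ 2 * k * Q * N * δ
    double = solve-∀

  large-g : Q * N * δ ≤ P * g → (2 * n + 1) * P * (δ * δ + g) ≤ 2 * (2 * n + 2) * Q * N * d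
  large-g δ≤Pg = begin
    (2 * n + 1) * P * (δ * δ + g)                 ≡⟨ distribute (2 * n + 1) P (δ * δ) g ⟩
    P * ((2 * n + 1) * (δ * δ) + (2 * n + 1) * g) ≤⟨ *-monoʳ-≤ P (+-monoˡ-≤ ((2 * n + 1) * g) δ²≤g) ⟩
    P * (g + (2 * n + 1) * g)                     ≡⟨ collect n P g ⟩
    (2 * n + 2) * (P * g)                         ≤⟨ *-monoʳ-≤ (2 * n + 2) Pg≤d ⟩
    (2 * n + 2) * (2 * Q * N * d)                 ≡⟨ regroup (2 * n + 2) Q N d ⟩
    2 * (2 * n + 2) * Q * N * d                   ∎
    where
    distribute : ∀ k P x g → k * P * (x + g) ≡ P * (k * x + k * g)
    distribute = solve-∀
    collect : ∀ n P g → P * (g + (2 * n + 1) * g) ≡ (2 * n + 2) * (P * g)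
    collect = solve-∀
    regroup : ∀ k Q N d → k * (2 * Q * N * d) ≡ 2 * k * Q * N * d
    regroup = solve-∀
    swap₁ : ∀ k P N δ → P * P * (N * N) * (k * (δ * δ)) ≡ k * (P * P) * (N * N * (δ * δ))
    swap₁ = solve-∀
    swap₂ : ∀ Q N δ → Q * Q * (N * N * (δ * δ)) ≡ (Q * N * δ) * (Q * N * δ)
    swap₂ = solve-∀
    swap₃ : ∀ P g → (P * g) * (P * g) ≡ P * P * g * g
    swap₃ = solve-∀
    swap₄ : ∀ x g y → x * g * y ≡ x * y * g
    swap₄ = solve-∀

    -- (2n+1)P²N²δ² ≤ (QNδ)² ≤ (Pg)² ≤ P²N²g; then P²N² cancels.
    δ²≤g : (2 * n + 1) * (δ * δ) ≤ g
    δ²≤g = *-cancelˡ-≤ (P * P * (N * N)) {{m*n≢0 (P * P) (N * N) {{m*n≢0 P P}} {{m*n≢0 N N}}}} (begin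
      P * P * (N * N) * ((2 * n + 1) * (δ * δ)) ≡⟨ swap₁ (2 * n + 1) P N δ ⟩
      (2 * n + 1) * (P * P) * (N * N * (δ * δ)) ≤⟨ *-monoˡ-≤ (N * N * (δ * δ)) P²≤Q² ⟩
      Q * Q * (N * N * (δ * δ))                 ≡⟨ swap₂ Q N δ ⟩
      (Q * N * δ) * (Q * N * δ)                 ≤⟨ *-mono-≤ δ≤Pg δ≤Pg ⟩
      (P * g) * (P * g)                         ≡⟨ swap₃ P g ⟩
      P * P * g * g                             ≤⟨ *-monoʳ-≤ (P * P * g) g≤N² ⟩
      P * P * g * (N * N)                       ≡⟨ swap₄ (P * P) g (N * N) ⟩
      P * P * (N * N) * g                       ∎)

odds≢0 : ∀ n → NonZero (odds n)
odds≢0 zero    = _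
odds≢0 (suc n) = m*n≢0 (2 * n + 1) (odds n) {{≢-nonZero (m+1+n≢0 (2 * n))}} {{odds≢0 n}}

argmax : ∀ {q} (a : Fin (suc q) → ℕ) → ∃[ c ] ∀ b → a b ≤ a c
argmax {zero}  a = Fin.zero , λ { Fin.zero → ≤-refl }
argmax {suc q} a with argmax (a ∘ Fin.suc)
... | c , a≤ with ≤-total (a Fin.zero) (a (Fin.suc c))
...   | inj₁ 0≤c = Fin.suc c , λ { Fin.zero → 0≤c ; (Fin.suc b) → a≤ b }
...   | inj₂ c≤0 = Fin.zero  , λ { Fin.zero → ≤-refl ; (Fin.suc b) → ≤-trans (a≤ b) c≤0 }

-- Because δ² + a (m + δ) = M δ + m a is linear in a and δ.
sum-variance : ∀ q M m (a δ : Fin q → ℕ) → (∀ b → a b + δ b ≡ M) →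
  q * sum (λ b → δ b * δ b + a b * (m + δ b)) ≡ sum a * sum (λ b → m + δ b) + sum δ * sum δ
sum-variance q M m a δ a+δ≡M = begin
  q * sum (λ b → δ b * δ b + a b * (m + δ b))     ≡⟨ cong (q *_) (sum-cong-≗ pointwise) ⟩
  q * sum (λ b → M * δ b + m * a b)               ≡⟨ cong (q *_) (∑-distrib-+ (λ b → M * δ b) (λ b → m * a b)) ⟩
  q * (sum (λ b → M * δ b) + sum (λ b → m * a b)) ≡⟨ cong (q *_) (cong₂ _+_ (*-distribˡ-sum M δ) (*-distribˡ-sum m a)) ⟨
  q * (M * D + m * A)                             ≡⟨ regroup q M m D A ⟩
  q * M * D + q * m * A                           ≡⟨ cong (λ z → z * D + q * m * A) qM ⟩
  (A + D) * D + q * m * A                         ≡⟨ collect (q * m) D A ⟩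
  A * (q * m + D) + D * D                         ≡⟨ cong (λ z → A * z + D * D) m+δ ⟨
  A * sum (λ b → m + δ b) + D * D                 ∎
  where
  open ≡-Reasoning
  A = sum a
  D = sum δ

  pointwise : ∀ b → δ b * δ b + a b * (m + δ b) ≡ M * δ b + m * a b
  pointwise b = trans (expanded (a b) (δ b) m) (cong (λ z → z * δ b + m * a b) (a+δ≡M b))
    where
    expanded : ∀ a δ m → δ * δ + a * (m + δ) ≡ (a + δ) * δ + m * a
    expanded = solve-∀

  qM : q * M ≡ A + D
  qM = begin
    q * M                 ≡⟨ sum-const q M ⟨
    sum {q} (λ _ → M)     ≡⟨ sum-cong-≗ a+δ≡M ⟨
    sum (λ b → a b + δ b) ≡⟨ ∑-distrib-+ a δ ⟩
    A + D                 ∎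

  m+δ : sum (λ b → m + δ b) ≡ q * m + D
  m+δ = trans (∑-distrib-+ (λ _ → m) δ) (cong (_+ D) (sum-const q m))

  regroup : ∀ q M m D A → q * (M * D + m * A) ≡ q * M * D + q * m * A
  regroup = solve-∀
  collect : ∀ k D A → (A + D) * D + k * A ≡ A * (k + D) + D * D
  collect = solve-∀

-- Each section satisfies the hypotheses of `section-growth`, and `sum-variance` adds up the
-- results. The term with `card f` stands on the left in place of a subtraction on the right.
isoperimetry : ∀ q {n} .{{_ : NonZero q}} (f : Vec (Fin q) n → Bool) →
  odds n * (card f * card (not ∘ f)) + 2 * evens n * q ^ n * card f ≤ 2 * evens n * q ^ n * card (expand f)
isoperimetry q {zero} f with f []
... | true  = ≤-refl
... | false = ≤-refl
isoperimetry q@(suc _) {suc n} f = begin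
  (2 * n + 1) * P * (A * A′) + 2 * Q′ * (q * N) * A
    ≤⟨ +-monoˡ-≤ (2 * Q′ * (q * N) * A) increment ⟩
  2 * Q′ * (q * N) * sum d + 2 * Q′ * (q * N) * A
    ≡⟨ factor (2 * Q′ * (q * N)) (sum d) A ⟩
  2 * Q′ * (q * N) * (A + sum d)
    ≡⟨ cong (2 * Q′ * (q * N) *_) (trans (sym (∑-distrib-+ a d)) (sum-cong-≗ a+d≡e)) ⟩
  2 * Q′ * (q * N) * sum e
    ∎
  where
  open ≤-Reasoning
  P  = odds n
  Q  = evens n
  Q′ = evens (suc n)
  N  = q ^ n

  section : Fin q → Vec (Fin q) n → Bool
  section b v = f (b ∷ v)

  a a′ e : Fin q → ℕ
  a  b = card (section b)
  a′ b = card (not ∘ section b)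
  e  b = card (λ v → expand f (b ∷ v))

  c = proj₁ (argmax a)
  M = a c
  m = N ∸ M
  A  = sum a
  A′ = sum a′

  δ d : Fin q → ℕ
  δ b = M ∸ a b
  d b = e b ∸ a b

  a+a′≡N : ∀ b → a b + a′ b ≡ N
  a+a′≡N b = card-not (section b)

  a≤N : ∀ b → a b ≤ N
  a≤N b = m+n≤o⇒m≤o (a b) (≤-reflexive (a+a′≡N b))

  a+δ≡M : ∀ b → a b + δ b ≡ M
  a+δ≡M b = m+[n∸m]≡n (proj₂ (argmax a) b)

  a′≡m+δ : ∀ b → a′ b ≡ m + δ b
  a′≡m+δ b = +-cancelˡ-≡ (a b) _ _ (≡.begin
    a b + a′ b      ≡.≡⟨ a+a′≡N b ⟩
    N               ≡.≡⟨ m+[n∸m]≡n (a≤N c) ⟨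
    M + m           ≡.≡⟨ cong (_+ m) (a+δ≡M b) ⟨
    a b + δ b + m   ≡.≡⟨ +-assoc (a b) (δ b) m ⟩
    a b + (δ b + m) ≡.≡⟨ cong (a b +_) (+-comm (δ b) m) ⟩
    a b + (m + δ b) ≡.∎)
    where module ≡ = ≡-Reasoning

  expand-section : ∀ b → card (expand (section b)) ≤ e b
  expand-section b = card-mono (λ v → bit-∨ˡ (expand (section b) v) _)

  -- Replacing the head c by b carries the largest section into this one.
  M≤e : ∀ b → M ≤ e b
  M≤e b = card-mono (λ v → ≤-trans (bit-anyᶠ (λ x → f (x ∷ v)) c) (bit-∨ʳ (expand (section b) v) _))

  a+d≡e : ∀ b → a b + d b ≡ e b
  a+d≡e b = m+[n∸m]≡n (≤-trans (proj₂ (argmax a) b) (M≤e b))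

  section-isoperimetry : ∀ b → P * (a b * a′ b) ≤ 2 * Q * N * d b
  section-isoperimetry b = +-cancelʳ-≤ (2 * Q * N * a b) _ _ (begin
    P * (a b * a′ b) + 2 * Q * N * a b    ≤⟨ isoperimetry q (section b) ⟩
    2 * Q * N * card (expand (section b)) ≤⟨ *-monoʳ-≤ (2 * Q * N) (expand-section b) ⟩
    2 * Q * N * e b                       ≡⟨ cong (2 * Q * N *_) (a+d≡e b) ⟨
    2 * Q * N * (a b + d b)               ≡⟨ *-distribˡ-+ (2 * Q * N) (a b) (d b) ⟩
    2 * Q * N * a b + 2 * Q * N * d b     ≡⟨ +-comm _ (2 * Q * N * d b) ⟩
    2 * Q * N * d b + 2 * Q * N * a b     ∎)

  growth : ∀ b → (2 * n + 1) * P * (δ b * δ b + a b * a′ b) ≤ 2 * (2 * n + 2) * Q * N * d b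
  growth b = section-growth n P Q N (δ b) (d b) (a b * a′ b) {{odds≢0 n}} {{m^n≢0 q n}}
    (odds≤evens n) (odds-upper n)
    (≤-trans (m∸n≤m M (a b)) (a≤N c))
    (*-mono-≤ (a≤N b) (m+n≤o⇒n≤o (a b) (≤-reflexive (a+a′≡N b))))
    (∸-monoˡ-≤ (a b) (M≤e b))
    (section-isoperimetry b)

  factor : ∀ k x y → k * x + k * y ≡ k * (y + x)
  factor = solve-∀
  swap : ∀ x y z → x * (y * z) ≡ y * (x * z)
  swap = solve-∀
  reassociate : ∀ q n Q N s → q * (2 * (2 * n + 2) * Q * N * s) ≡ 2 * ((2 * n + 2) * Q) * (q * N) * s
  reassociate = solve-∀

  increment : (2 * n + 1) * P * (A * A′) ≤ 2 * Q′ * (q * N) * sum d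
  increment = begin
    (2 * n + 1) * P * (A * A′)
      -- The added square completes the right-hand side of `sum-variance`.
      ≤⟨ *-monoʳ-≤ ((2 * n + 1) * P) (m≤m+n (A * A′) (sum δ * sum δ)) ⟩
    (2 * n + 1) * P * (A * A′ + sum δ * sum δ)
      ≡⟨ cong (λ z → (2 * n + 1) * P * (A * z + sum δ * sum δ)) (sum-cong-≗ a′≡m+δ) ⟩
    (2 * n + 1) * P * (A * sum (λ b → m + δ b) + sum δ * sum δ)
      ≡⟨ cong ((2 * n + 1) * P *_) (sum-variance q M m a δ a+δ≡M) ⟨
    (2 * n + 1) * P * (q * sum (λ b → δ b * δ b + a b * (m + δ b)))
      ≡⟨ swap ((2 * n + 1) * P) q (sum (λ b → δ b * δ b + a b * (m + δ b))) ⟩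
    q * ((2 * n + 1) * P * sum (λ b → δ b * δ b + a b * (m + δ b)))
      ≡⟨ cong (λ z → q * ((2 * n + 1) * P * z)) (sum-cong-≗ (λ b → cong (λ z → δ b * δ b + a b * z) (a′≡m+δ b))) ⟨
    q * ((2 * n + 1) * P * sum (λ b → δ b * δ b + a b * a′ b))
      ≡⟨ cong (q *_) (*-distribˡ-sum ((2 * n + 1) * P) (λ b → δ b * δ b + a b * a′ b)) ⟩
    q * sum (λ b → (2 * n + 1) * P * (δ b * δ b + a b * a′ b))
      ≤⟨ *-monoʳ-≤ q (sum-mono-≤ growth) ⟩
    q * sum (λ b → 2 * (2 * n + 2) * Q * N * d b)
      ≡⟨ cong (q *_) (*-distribˡ-sum (2 * (2 * n + 2) * Q * N) d) ⟨
    q * (2 * (2 * n + 2) * Q * N * sum d)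
      ≡⟨ reassociate q n Q N (sum d) ⟩
    2 * Q′ * (q * N) * sum d
      ∎

-- Growth over t steps and separators in Hamming graphs

card-≤-+ : ∀ {q n} {f g h : Vec (Fin q) n → Bool} →
           (∀ v → bit (f v) ≤ bit (g v) + bit (h v)) → card f ≤ card g + card h
card-≤-+ {n = zero} f≤g+h = f≤g+h []
card-≤-+ {n = suc n} {f} {g} {h} f≤g+h = ≤-trans
  (sum-mono-≤ (λ b → card-≤-+ {f = λ v → f (b ∷ v)} {λ v → g (b ∷ v)} {λ v → h (b ∷ v)} (λ v → f≤g+h (b ∷ v))))
  (≤-reflexive (∑-distrib-+ (λ b → card (λ v → g (b ∷ v))) (λ b → card (λ v → h (b ∷ v)))))

expandⁿ : ∀ {q n} → ℕ → (Vec (Fin q) n → Bool) → Vec (Fin q) n → Bool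
expandⁿ zero    f = f
expandⁿ (suc t) f = expand (expandⁿ t f)

f⊆expandⁿ : ∀ {q n} t (f : Vec (Fin q) n → Bool) v → bit (f v) ≤ bit (expandⁿ t f v)
f⊆expandⁿ zero    f v = ≤-refl
f⊆expandⁿ (suc t) f v = ≤-trans (f⊆expandⁿ t f v) (f⊆expand (expandⁿ t f) v)

-- Every intermediate neighbourhood contains f and avoids g, so each of the t steps gains at least
-- what the product |f| |g| yields.
isoperimetryⁿ : ∀ t q {n} .{{_ : NonZero q}} (f g : Vec (Fin q) n → Bool) →
  (∀ v → bit (g v) ≤ bit (not (expandⁿ t f v))) →
  t * (odds n * (card f * card g)) + 2 * evens n * q ^ n * card f ≤ 2 * evens n * q ^ n * card (expandⁿ t f)
isoperimetryⁿ zero    q f g disjoint = ≤-refl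
isoperimetryⁿ (suc t) q {n} f g disjoint = begin
  P * (α * β) + t * (P * (α * β)) + k * α   ≡⟨ +-assoc (P * (α * β)) _ _ ⟩
  P * (α * β) + (t * (P * (α * β)) + k * α) ≤⟨ +-mono-≤ (*-monoʳ-≤ P (*-mono-≤ α≤ (card-mono disjointᵗ))) (isoperimetryⁿ t q f g disjointᵗ) ⟩
  P * (card F * card (not ∘ F)) + k * card F ≤⟨ isoperimetry q F ⟩
  k * card (expand F)                       ∎
  where
  open ≤-Reasoning
  F = expandⁿ t f
  P = odds n
  k = 2 * evens n * q ^ n
  α = card f
  β = card g

  bit-not-antitone : ∀ {a b} → bit a ≤ bit b → bit (not b) ≤ bit (not a)
  bit-not-antitone {true}  {true}  _ = ≤-refl
  bit-not-antitone {false} {true}  _ = z≤n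
  bit-not-antitone {false} {false} _ = ≤-refl

  disjointᵗ : ∀ v → bit (g v) ≤ bit (not (F v))
  disjointᵗ v = ≤-trans (disjoint v) (bit-not-antitone (f⊆expand F v))

  α≤ : α ≤ card F
  α≤ = card-mono (f⊆expandⁿ t f)

hamming-∷ : ∀ {q n} b (u v : Vec (Fin q) n) → hamming (b ∷ u) (b ∷ v) ≡ hamming u v
hamming-∷ b u v with b ≟ᶠ b
... | yes _  = refl
... | no b≢b = contradiction refl b≢b

hamming-refl : ∀ {q n} (v : Vec (Fin q) n) → hamming v v ≡ 0
hamming-refl []      = refl
hamming-refl (b ∷ v) = trans (hamming-∷ b v v) (hamming-refl v)

hamming-head : ∀ {q n} b c (v : Vec (Fin q) n) → hamming (b ∷ v) (c ∷ v) ≤ 1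
hamming-head b c v with b ≟ᶠ c
... | yes _ = ≤-trans (≤-reflexive (hamming-refl v)) z≤n
... | no _  = s≤s (≤-reflexive (hamming-refl v))

hamming-triangle : ∀ {q n} (u v w : Vec (Fin q) n) → hamming u w ≤ hamming u v + hamming v w
hamming-triangle []      []      []      = z≤n
hamming-triangle (a ∷ u) (b ∷ v) (c ∷ w) with a ≟ᶠ c | a ≟ᶠ b | b ≟ᶠ c
... | yes _  | yes _   | yes _   = hamming-triangle u v w
... | yes _  | yes _   | no _    = ≤-trans (hamming-triangle u v w) (+-monoʳ-≤ (hamming u v) (n≤1+n _))
... | yes _  | no _    | yes _   = ≤-trans (hamming-triangle u v w) (n≤1+n _)
... | yes _  | no _    | no _    = ≤-trans (hamming-triangle u v w) (+-mono-≤ (n≤1+n _) (n≤1+n _))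
... | no _   | yes _   | no _    = ≤-trans (s≤s (hamming-triangle u v w)) (≤-reflexive (sym (+-suc (hamming u v) _)))
... | no _   | no _    | yes _   = s≤s (hamming-triangle u v w)
... | no _   | no _    | no _    = s≤s (≤-trans (hamming-triangle u v w) (+-monoʳ-≤ (hamming u v) (n≤1+n _)))
... | no a≢c | yes a≡b | yes b≡c = contradiction (trans a≡b b≡c) a≢c

∨-true : ∀ {a b} → a ∨ b ≡ true → a ≡ true ⊎ b ≡ true
∨-true {true}  _ = inj₁ refl
∨-true {false} b = inj₂ b

anyᶠ-witness : ∀ {q} (f : Fin q → Bool) → anyᶠ f ≡ true → ∃[ c ] f c ≡ true
anyᶠ-witness {suc q} f any with ∨-true any
... | inj₁ now   = Fin.zero , now
... | inj₂ later with anyᶠ-witness (f ∘ Fin.suc) later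
...   | c , fc = Fin.suc c , fc

expand-near : ∀ {q n} (f : Vec (Fin q) n → Bool) v → expand f v ≡ true → ∃[ u ] f u ≡ true × hamming u v ≤ 1
expand-near f []      fv = [] , fv , z≤n
expand-near f (b ∷ v) fv with ∨-true fv
... | inj₁ tail with expand-near (λ u → f (b ∷ u)) v tail
...   | u , fu , u~v = b ∷ u , fu , ≤-trans (≤-reflexive (hamming-∷ b u v)) u~v
expand-near f (b ∷ v) fv | inj₂ head with anyᶠ-witness (λ c → f (c ∷ v)) head
...   | c , fc = c ∷ v , fc , hamming-head c b v

expandⁿ-near : ∀ {q n} t (f : Vec (Fin q) n → Bool) v → expandⁿ t f v ≡ true → ∃[ u ] f u ≡ true × hamming u v ≤ t
expandⁿ-near zero    f v fv = v , fv , ≤-reflexive (hamming-refl v)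
expandⁿ-near (suc t) f v fv with expand-near (expandⁿ t f) v fv
... | w , fw , w~v with expandⁿ-near t f w fw
...   | u , fu , u~w = u , fu , ≤-trans (hamming-triangle u w v) (≤-trans (+-mono-≤ u~w w~v) (≤-reflexive (+-comm t 1)))

-- The t-fold neighbourhood of f does not meet g, so all that it contains beyond f lies in s.
separator-size : ∀ t q {n} .{{_ : NonZero q}} (f g s : Vec (Fin q) n → Bool) →
  (∀ u v → f u ≡ true → g v ≡ true → ¬ hamming u v ≤ t) →
  (∀ v → f v ≡ false → s v ≡ false → g v ≡ true) →
  t * (odds n * (card f * card g)) ≤ 2 * evens n * q ^ n * card s
separator-size t q {n} f g s separated covers = +-cancelʳ-≤ (k * card f) _ _ (begin
  t * (odds n * (card f * card g)) + k * card f ≤⟨ isoperimetryⁿ t q f g (λ v → bound v (expandⁿ t f v) (g v) refl refl) ⟩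
  k * card (expandⁿ t f)                        ≤⟨ *-monoʳ-≤ k (card-≤-+ {h = f} (λ v → bound′ v (expandⁿ t f v) (s v) (f v) refl refl refl)) ⟩
  k * (card s + card f)                         ≡⟨ *-distribˡ-+ k (card s) (card f) ⟩
  k * card s + k * card f                       ∎)
  where
  open ≤-Reasoning
  k = 2 * evens n * q ^ n

  apart : ∀ v → expandⁿ t f v ≡ true → ¬ g v ≡ true
  apart v fv gv with expandⁿ-near t f v fv
  ... | u , fu , u~v = separated u v fu gv u~v

  bound : ∀ v x y → expandⁿ t f v ≡ x → g v ≡ y → bit y ≤ bit (not x)
  bound v _     false _  _  = z≤n
  bound v false true  _  _  = ≤-refl
  bound v true  true  fv gv = contradiction gv (apart v fv)

  bound′ : ∀ v x y z → expandⁿ t f v ≡ x → s v ≡ y → f v ≡ z → bit x ≤ bit y + bit z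
  bound′ v false _     _     _  _  _  = z≤n
  bound′ v true  true  _     _  _  _  = s≤s z≤n
  bound′ v true  false true  _  _  _  = ≤-refl
  bound′ v true  false false xv sv fv = contradiction (covers v fv sv) (apart v xv)

-- Balanced parts of a tree

lookup-injective : ∀ {s} {xs : List (Fin s)} → Unique xs → ∀ i j → lookup xs i ≡ lookup xs j → i ≡ j
lookup-injective (x∉ ∷ uniq) Fin.zero    Fin.zero    _  = refl
lookup-injective (x∉ ∷ uniq) Fin.zero    (Fin.suc j) eq = contradiction eq (All.lookup x∉ (∈-lookup j))
lookup-injective (x∉ ∷ uniq) (Fin.suc i) Fin.zero    eq = contradiction (sym eq) (All.lookup x∉ (∈-lookup i))
lookup-injective (x∉ ∷ uniq) (Fin.suc i) (Fin.suc j) eq = cong Fin.suc (lookup-injective uniq i j eq)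

unique-length : ∀ {s} {xs : List (Fin s)} → Unique xs → length xs ≤ s
unique-length uniq = injective⇒≤ (λ {i} {j} → lookup-injective uniq i j)

module _ {s} (G : Graph (Fin s)) (tree : IsTree G) where
  open Graph G
  open IsTree tree

  -- Here p is the segment of `rest` that ends in z. That it lies within `rest` is stated through
  -- predicates, the form in which the disequalities of `Unique` pass from `rest` to p.
  close-chord : ∀ {x y z rest} → Unique (x ∷ rest) → Linked Adj (x ∷ rest) → z ∈ rest → Adj z y →
    ∃[ p ] 1 ≤ length p × Unique (x ∷ p) × Linked Adj (x ∷ p ∷ʳ y) ×
           (∀ {P : Fin s → Set} → All P rest → All P p)
  close-chord ((x≢z ∷ _) ∷ _) (xz ∷ _) (here refl) zy =
    _ ∷ [] , s≤s z≤n , (x≢z ∷ []) ∷ ([] ∷ []) , xz ∷ (zy ∷ [-]) , λ { (pz ∷ _) → pz ∷ [] }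
  close-chord (x∉ ∷ uniq) (xr ∷ linked) (there z∈) zy with close-chord uniq linked z∈ zy
  ... | p , _ , uniq′ , linked′ , sub =
    _ ∷ p , s≤s z≤n , sub′ x∉ ∷ uniq′ , xr ∷ linked′ , sub′
    where
    sub′ : ∀ {P : Fin s → Set} → All P _ → All P _
    sub′ (pr ∷ prs) = pr ∷ sub prs

  -- The chord would close the segment from y to z to a cycle, which has at least three vertices
  -- because z comes after x.
  no-chord : ∀ {x y z rest} → Unique (y ∷ x ∷ rest) → Linked Adj (y ∷ x ∷ rest) → z ∈ rest → ¬ Adj z y
  no-chord {x} {y} ((y≢x ∷ y∉) ∷ uniq) (yx ∷ linked) z∈ zy with close-chord uniq linked z∈ zy
  ... | p , 1≤p , uniq′ , linked′ , sub =
    acyclic y (x ∷ p) (s≤s (s≤s 1≤p) , ((y≢x ∷ sub y∉) ∷ uniq′) , yx ∷ linked′)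

  -- Edges leave S only at i. Hence a connected set of nodes that meets S and avoids i stays in S.
  HangsAt : Fin s → List (Fin s) → Set
  HangsAt i S = i ∈ S × (∀ {x y} → x ∈ S → x ≢ i → Adj x y → y ∈ S)

  module _ (μ : List (Fin s) → ℕ) (N : ℕ) (μ-++ : ∀ S S′ → μ (S ++ S′) ≤ μ S + μ S′) where

    -- The summand for i admits a single node whose own measure already reaches N/3. It does no harm
    -- later, when the bag of i is the separator.
    Balanced : Set
    Balanced = ∃[ i ] ∃[ S ] HangsAt i S × N ≤ 3 * μ S × 3 * μ S ≤ 2 * N + 3 * μ (i ∷ [])

    -- The state of the search at j: `visited` is the path by which j was reached, `done` the list
    -- of nodes already tested as neighbours of j. In `Explored` all of them have been tested, and
    -- edges leave S only from j back into that path.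
    Below : Fin s → List (Fin s) → List (Fin s) → Set
    Below j visited done = ∃[ S ] HangsAt j S × 3 * μ S < N ×
                                  (∀ {y} → y ∈ done → Adj j y → y ∈ S ⊎ y ∈ visited)

    Explored : Fin s → List (Fin s) → Set
    Explored j rest = ∃[ S ] j ∈ S × 3 * μ S < N × (∀ {x y} → x ∈ S → Adj x y → y ∈ S ⊎ (x ≡ j × y ∈ rest))

    attach : ∀ {j rest done} y → Unique (j ∷ rest) → Linked Adj (j ∷ rest) → Adj j y → y ∉ rest →
             Explored y (j ∷ rest) → Below j rest done → Balanced ⊎ Below j rest (y ∷ done)
    attach {j} {rest} {done} y uniq@(j∉ ∷ _) linked jy y∉ (S′ , y∈S′ , small′ , closed′) (S , (j∈S , hangs) , small , complete) =
      conclude (<-≤-connex (3 * μ (S′ ++ S)) N)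
      where
      closed⁺ : ∀ {x z} → x ∈ S′ ++ S → x ≢ j → Adj x z → z ∈ S′ ++ S
      closed⁺ x∈ x≢j xz with ∈-++⁻ S′ x∈
      ... | inj₂ x∈S = ∈-++⁺ʳ S′ (hangs x∈S x≢j xz)
      ... | inj₁ x∈S′ with closed′ x∈S′ xz
      ...   | inj₁ z∈S′ = ∈-++⁺ˡ z∈S′
      ...   | inj₂ (refl , here refl) = ∈-++⁺ʳ S′ j∈S
      -- An edge from y to a node of the path before j would be a chord.
      ...   | inj₂ (refl , there z∈)  =
        contradiction (adj-sym xz) (no-chord (((λ y≡j → adj-irrefl (sym y≡j) jy) ∷ ¬Any⇒All¬ rest y∉) ∷ uniq) (adj-sym jy ∷ linked) z∈)

      hangs⁺ : HangsAt j (S′ ++ S)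
      hangs⁺ = ∈-++⁺ʳ S′ j∈S , closed⁺

      complete⁺ : ∀ {z} → z ∈ y ∷ done → Adj j z → z ∈ S′ ++ S ⊎ z ∈ rest
      complete⁺ (here refl) _  = inj₁ (∈-++⁺ˡ y∈S′)
      complete⁺ (there z∈)  jz = map₁ (∈-++⁺ʳ S′) (complete z∈ jz)

      bounded : 3 * μ (S′ ++ S) ≤ 2 * N + 3 * μ (j ∷ [])
      bounded = begin
        3 * μ (S′ ++ S)         ≤⟨ *-monoʳ-≤ 3 (μ-++ S′ S) ⟩
        3 * (μ S′ + μ S)        ≡⟨ *-distribˡ-+ 3 (μ S′) (μ S) ⟩
        3 * μ S′ + 3 * μ S      ≤⟨ +-mono-≤ (<⇒≤ small′) (<⇒≤ small) ⟩
        N + N                   ≡⟨ cong (N +_) (+-identityʳ N) ⟨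
        2 * N                   ≤⟨ m≤m+n (2 * N) _ ⟩
        2 * N + 3 * μ (j ∷ [])  ∎
        where open ≤-Reasoning

      conclude : 3 * μ (S′ ++ S) < N ⊎ N ≤ 3 * μ (S′ ++ S) → Balanced ⊎ Below j rest (y ∷ done)
      conclude (inj₁ <N) = inj₂ (S′ ++ S , hangs⁺ , <N , complete⁺)
      conclude (inj₂ N≤) = inj₁ (j , S′ ++ S , hangs⁺ , N≤ , bounded)

    -- Depth-first search along simple paths, which acyclicity keeps from meeting
    -- themselves.  Parts of measure below N/3 are collected at a node until their
    -- union reaches N/3; it is then still below 2N/3.
    explore : ∀ fuel j rest → s ≤ length rest + fuel → Unique (j ∷ rest) → Linked Adj (j ∷ rest) →
              Balanced ⊎ Explored j rest
    explore-neighbours : ∀ fuel j rest → s ≤ length rest + suc fuel → Unique (j ∷ rest) → Linked Adj (j ∷ rest) →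
                         3 * μ (j ∷ []) < N → ∀ todo → Balanced ⊎ Below j rest todo

    -- Without fuel the simple path would have more than s nodes.
    explore zero j rest enough uniq linked = contradiction
      (≤-trans (unique-length uniq) (≤-trans enough (≤-reflexive (+-identityʳ _)))) 1+n≰n
    explore (suc fuel) j rest enough uniq linked with <-≤-connex (3 * μ (j ∷ [])) N
    ... | inj₂ N≤ = inj₁ (j , j ∷ [] , (here refl , λ { (here refl) j≢j → contradiction refl j≢j }) , N≤ , m≤n+m _ (2 * N))
    ... | inj₁ <N with explore-neighbours fuel j rest enough uniq linked <N (allFin s)
    ...   | inj₁ found = inj₁ found
    ...   | inj₂ (S , (j∈S , closed) , small , complete) = inj₂ (S , j∈S , small , closed′)
      where
      closed′ : ∀ {x y} → x ∈ S → Adj x y → y ∈ S ⊎ (x ≡ j × y ∈ rest)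
      closed′ {x} x∈S xy with x ≟ᶠ j
      ... | no x≢j   = inj₁ (closed x∈S x≢j xy)
      ... | yes refl = map₂ (λ y∈ → refl , y∈) (complete (∈-allFin _) xy)

    explore-neighbours fuel j rest enough uniq linked <N [] =
      inj₂ (j ∷ [] , (here refl , λ { (here refl) j≢j → contradiction refl j≢j }) , <N , λ ())
    explore-neighbours fuel j rest enough uniq linked <N (y ∷ todo)
      with explore-neighbours fuel j rest enough uniq linked <N todo | adj? j y | any? (y ≟ᶠ_) rest
    ... | inj₁ found | _ | _ = inj₁ found
    ... | inj₂ (S , hangs , small , complete) | no ¬jy | _ =
      inj₂ (S , hangs , small , λ { (here refl) jy → contradiction jy ¬jy ; (there z∈) jz → complete z∈ jz })
    ... | inj₂ (S , hangs , small , complete) | yes _ | yes y∈ =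
      inj₂ (S , hangs , small , λ { (here refl) _ → inj₂ y∈ ; (there z∈) jz → complete z∈ jz })
    ... | inj₂ below | yes jy | no y∉
      with explore fuel y (j ∷ rest) (≤-trans enough (≤-reflexive (+-suc (length rest) fuel)))
             (((λ y≡j → adj-irrefl (sym y≡j) jy) ∷ ¬Any⇒All¬ rest y∉) ∷ uniq) (adj-sym jy ∷ linked)
    ...   | inj₁ found    = inj₁ found
    ...   | inj₂ explored = attach y uniq linked jy y∉ explored below

    -- No path leads to the root, so a search that finds nothing there returns a set closed under
    -- all edges. By connectedness it is the whole tree, whose measure is not below N/3.
    balanced : (∀ S → (∀ i → i ∈ S) → N ≤ μ S) → Balanced
    balanced full with explore s root [] ≤-refl ([] ∷ []) [-]
    ... | inj₁ found = found
    ... | inj₂ (S , r∈S , small , closed) = contradiction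
      (≤-trans small (≤-trans (full S (λ i → reach r∈S (connected root i))) (m≤m+n (μ S) _))) 1+n≰n
      where
      reach : ∀ {x y} → x ∈ S → Star Adj x y → y ∈ S
      reach x∈S ε = x∈S
      reach x∈S (xz ◅ zy) with closed x∈S xz
      ... | inj₁ z∈S = reach z∈S zy

-- Separators and the lower bound

-- Here x is the size of the bag, α and β are those of the sets it separates. If N ≤ 12x, then t² ≤
-- n is enough. Otherwise α and β are at least N/4, so tpN ≤ 32ex, and e² ≤ 4np² gives the constant
-- 4096 = 32² · 4.
balanced-separator : ∀ n t p e N μ α β x .{{_ : NonZero p}} .{{_ : NonZero N}} →
  N ≤ 3 * μ → 3 * μ ≤ 2 * N + 3 * x → μ ≤ α + x → μ + β ≡ N →
  t * (p * (α * β)) ≤ 2 * e * N * x → e * e ≤ 4 * n * (p * p) → t * t ≤ n →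
  t * N * (t * N) ≤ 4096 * n * (x * x)
balanced-separator n t p e N μ α β x N≤3μ 3μ≤ μ≤α+x μ+β≡N bound e² t²≤n = [ large , small ]′ (≤-total N (12 * x))
  where
  open ≤-Reasoning

  large : N ≤ 12 * x → t * N * (t * N) ≤ 4096 * n * (x * x)
  large N≤12x = begin
    t * N * (t * N)               ≡⟨ regroup t N ⟩
    t * t * (N * N)               ≤⟨ *-mono-≤ t²≤n (*-mono-≤ N≤12x N≤12x) ⟩
    n * (12 * x * (12 * x))       ≡⟨ collect n x ⟩
    144 * n * (x * x)             ≤⟨ *-monoˡ-≤ (x * x) (*-monoˡ-≤ n (m≤m+n 144 3952)) ⟩
    4096 * n * (x * x)            ∎
    where
    regroup : ∀ t N → t * N * (t * N) ≡ t * t * (N * N)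
    regroup = solve-∀
    collect : ∀ n x → n * (12 * x * (12 * x)) ≡ 144 * n * (x * x)
    collect = solve-∀

  small : 12 * x ≤ N → t * N * (t * N) ≤ 4096 * n * (x * x)
  small 12x≤N = *-cancelˡ-≤ (p * p) {{m*n≢0 p p}} (begin
    p * p * (t * N * (t * N))       ≡⟨ regroup₁ p t N ⟩
    t * p * N * (t * p * N)         ≤⟨ *-mono-≤ tpN≤ tpN≤ ⟩
    32 * e * x * (32 * e * x)       ≡⟨ regroup₂ e x ⟩
    1024 * (x * x) * (e * e)        ≤⟨ *-monoʳ-≤ (1024 * (x * x)) e² ⟩
    1024 * (x * x) * (4 * n * (p * p)) ≡⟨ regroup₃ n p x ⟩
    p * p * (4096 * n * (x * x))    ∎)
    where
    quadruple : ∀ N z → 4 * N ≤ 12 * z + N → N ≤ 4 * z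
    quadruple N z 4N≤ = *-cancelˡ-≤ 3 (+-cancelʳ-≤ N _ _ (begin
      3 * N + N      ≡⟨ split N ⟩
      4 * N          ≤⟨ 4N≤ ⟩
      12 * z + N     ≡⟨ cong (_+ N) (*-assoc 3 4 z) ⟩
      3 * (4 * z) + N ∎))
      where
      split : ∀ N → 3 * N + N ≡ 4 * N
      split = solve-∀

    N≤4α : N ≤ 4 * α
    N≤4α = quadruple N α (begin
      4 * N             ≤⟨ *-monoʳ-≤ 4 N≤3μ ⟩
      4 * (3 * μ)       ≡⟨ *-assoc 4 3 μ ⟨
      12 * μ            ≤⟨ *-monoʳ-≤ 12 μ≤α+x ⟩
      12 * (α + x)      ≡⟨ *-distribˡ-+ 12 α x ⟩
      12 * α + 12 * x   ≤⟨ +-monoʳ-≤ (12 * α) 12x≤N ⟩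
      12 * α + N        ∎)

    N≤3x+3β : N ≤ 3 * x + 3 * β
    N≤3x+3β = +-cancelˡ-≤ (2 * N) _ _ (begin
      2 * N + N                   ≡⟨ split N ⟩
      3 * N                       ≡⟨ cong (3 *_) μ+β≡N ⟨
      3 * (μ + β)                 ≡⟨ *-distribˡ-+ 3 μ β ⟩
      3 * μ + 3 * β               ≤⟨ +-monoˡ-≤ (3 * β) 3μ≤ ⟩
      2 * N + 3 * x + 3 * β       ≡⟨ +-assoc (2 * N) (3 * x) (3 * β) ⟩
      2 * N + (3 * x + 3 * β)     ∎)
      where
      split : ∀ N → 2 * N + N ≡ 3 * N
      split = solve-∀

    N≤4β : N ≤ 4 * β
    N≤4β = quadruple N β (begin
      4 * N                 ≤⟨ *-monoʳ-≤ 4 N≤3x+3β ⟩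
      4 * (3 * x + 3 * β)   ≡⟨ expand-sum x β ⟩
      12 * β + 12 * x       ≤⟨ +-monoʳ-≤ (12 * β) 12x≤N ⟩
      12 * β + N            ∎)
      where
      expand-sum : ∀ x β → 4 * (3 * x + 3 * β) ≡ 12 * β + 12 * x
      expand-sum = solve-∀

    tpN≤ : t * p * N ≤ 32 * e * x
    tpN≤ = *-cancelʳ-≤ _ _ N (begin
      t * p * N * N                   ≡⟨ *-assoc (t * p) N N ⟩
      t * p * (N * N)                 ≤⟨ *-monoʳ-≤ (t * p) (*-mono-≤ N≤4α N≤4β) ⟩
      t * p * (4 * α * (4 * β))       ≡⟨ collect t p α β ⟩
      16 * (t * (p * (α * β)))        ≤⟨ *-monoʳ-≤ 16 bound ⟩
      16 * (2 * e * N * x)            ≡⟨ swap e N x ⟩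
      32 * e * x * N                  ∎)
      where
      collect : ∀ t p α β → t * p * (4 * α * (4 * β)) ≡ 16 * (t * (p * (α * β)))
      collect = solve-∀
      swap : ∀ e N x → 16 * (2 * e * N * x) ≡ 32 * e * x * N
      swap = solve-∀

    regroup₁ : ∀ p t N → p * p * (t * N * (t * N)) ≡ t * p * N * (t * p * N)
    regroup₁ = solve-∀
    regroup₂ : ∀ e x → 32 * e * x * (32 * e * x) ≡ 1024 * (x * x) * (e * e)
    regroup₂ = solve-∀
    regroup₃ : ∀ n p x → 1024 * (x * x) * (4 * n * (p * p)) ≡ p * p * (4096 * n * (x * x))
    regroup₃ = solve-∀

bit-does : ∀ {P Q R : Set} (P? : Dec P) (Q? : Dec Q) (R? : Dec R) → (P → Q ⊎ R) →
           bit (does P?) ≤ bit (does Q?) + bit (does R?)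
bit-does (no _)  _       _       _   = z≤n
bit-does (yes _) (yes _) _       _   = s≤s z≤n
bit-does (yes _) (no _)  (yes _) _   = ≤-refl
bit-does (yes p) (no ¬q) (no ¬r) pqr = contradiction (pqr p) [ ¬q , ¬r ]′

does-true : ∀ {P : Set} (P? : Dec P) → does P? ≡ true → P
does-true (yes p) _ = p

does-false : ∀ {P : Set} (P? : Dec P) → does P? ≡ false → ¬ P
does-false (no ¬p) _ = ¬p

_∈ⱽ?_ : ∀ {q n} (v : Vec (Fin q) n) (l : List (Vec (Fin q) n)) → Dec (v ∈ l)
v ∈ⱽ? l = any? (≡-dec _≟ᶠ_ v) l

card-singleton : ∀ {q n} (u : Vec (Fin q) n) → card (λ v → does (≡-dec _≟ᶠ_ v u)) ≤ 1
card-singleton []              = ≤-refl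
card-singleton {q} {suc n} (b ∷ u) = ≤-trans (sum-mono-≤ slice) (indicator b)
  where
  slice : ∀ c → card (λ v → does (≡-dec _≟ᶠ_ (c ∷ v) (b ∷ u))) ≤ bit (does (c ≟ᶠ b))
  slice c with c ≟ᶠ b
  ... | yes _ = card-singleton u
  ... | no _  = ≤-reflexive (card-false {q} {n})

  indicator : ∀ {q} (b : Fin q) → sum (λ c → bit (does (c ≟ᶠ b))) ≤ 1
  indicator {suc q} Fin.zero    = s≤s (≤-reflexive (trans (sum-const q 0) (*-zeroʳ q)))
  indicator {suc q} (Fin.suc b) = indicator b

card-∈ : ∀ {q n} (l : List (Vec (Fin q) n)) → card (λ v → does (v ∈ⱽ? l)) ≤ length l
card-∈ {q} {n} []      = ≤-reflexive (card-false {q} {n})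
card-∈         (u ∷ l) = ≤-trans
  (card-≤-+ {f = λ v → does (v ∈ⱽ? (u ∷ l))} (λ v → bit-does (v ∈ⱽ? (u ∷ l)) (≡-dec _≟ᶠ_ v u) (v ∈ⱽ? l)
    λ { (here v≡u) → inj₁ v≡u ; (there v∈) → inj₂ v∈ }))
  (+-mono-≤ (card-singleton u) (card-∈ l))

module _ {t q n} .{{_ : NonZero q}} (1≤n : 1 ≤ n) (t²≤n : t * t ≤ n) (D : TreeDecomposition (H t q n)) where
  open TreeDecomposition D

  covered? : ∀ S (v : Vec (Fin q) n) → Dec (Any (λ i → v ∈ bag i) S)
  covered? S v = any? (λ i → v ∈ⱽ? bag i) S

  -- The measure of a set of nodes is the size of the union of their bags. Bag i separates the rest
  -- of the union over S from the complement of that union.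
  large-bag : ∃[ i ] t * q ^ n * (t * q ^ n) ≤ 4096 * n * (length (bag i) * length (bag i))
  large-bag with balanced tree isTree (λ S → card (does ∘ covered? S)) (q ^ n) subadditive full
    where
    subadditive : ∀ S S′ → card (does ∘ covered? (S ++ S′)) ≤ card (does ∘ covered? S) + card (does ∘ covered? S′)
    subadditive S S′ = card-≤-+ {f = does ∘ covered? (S ++ S′)}
      (λ v → bit-does (covered? (S ++ S′) v) (covered? S v) (covered? S′ v) (++⁻ S))

    full : ∀ S → (∀ i → i ∈ S) → q ^ n ≤ card (does ∘ covered? S)
    full S all = ≤-trans (≤-reflexive (sym (card-true {q} {n}))) (card-mono everywhere)
      where
      everywhere : ∀ v → 1 ≤ bit (does (covered? S v))
      everywhere v with covered? S v
      ... | yes _ = ≤-refl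
      ... | no ¬c = contradiction (lose (all (proj₁ (vertex-cov v))) (proj₂ (vertex-cov v))) ¬c
  ... | i , S , (i∈S , hangs) , N≤3μ , 3μ≤ = i ,
    balanced-separator n t (odds n) (evens n) (q ^ n) (card inS) (card inside) (card outside) (length (bag i))
      {{odds≢0 n}} {{m^n≢0 q n}}
      N≤3μ (≤-trans 3μ≤ (+-monoʳ-≤ (2 * q ^ n) (*-monoʳ-≤ 3 bag-size)))
      (≤-trans (card-≤-+ {f = inS} {inside} {inBag} split) (+-monoʳ-≤ (card inside) (card-∈ (bag i))))
      (card-not inS)
      (≤-trans (separator-size t q inside outside inBag separated covers) (*-monoʳ-≤ (2 * evens n * q ^ n) (card-∈ (bag i))))
      (evens²≤ n 1≤n) t²≤n
    where
    inS inBag inside outside : Vec (Fin q) n → Bool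
    inS       = does ∘ covered? S
    inBag   v = does (v ∈ⱽ? bag i)
    inside  v = inS v ∧ not (inBag v)
    outside v = not (inS v)

    evens²≤ : ∀ n → 1 ≤ n → evens n * evens n ≤ 4 * n * (odds n * odds n)
    evens²≤ (suc n) _ = odds-lower n

    bag-size : card (does ∘ covered? (i ∷ [])) ≤ length (bag i)
    bag-size = ≤-trans (card-mono {f = does ∘ covered? (i ∷ [])} {inBag} only) (card-∈ (bag i))
      where
      only : ∀ v → bit (does (covered? (i ∷ []) v)) ≤ bit (inBag v)
      only v with v ∈ⱽ? bag i
      ... | yes _ = ≤-refl
      ... | no _  = ≤-refl

    split : ∀ v → bit (inS v) ≤ bit (inside v) + bit (inBag v)
    split v with inS v | inBag v
    ... | false | _     = z≤n
    ... | true  | true  = ≤-refl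
    ... | true  | false = ≤-refl

    covers : ∀ v → inside v ≡ false → inBag v ≡ false → outside v ≡ true
    covers v with inS v | inBag v
    ... | false | _     = λ _ _ → refl
    ... | true  | true  = λ _ ()
    ... | true  | false = λ ()

    -- The nodes whose bags contain v avoid i, and i is the only way out of S.
    exit : ∀ {v j k} → v ∉ bag i → j ∈ S → Star (λ x y → Graph.Adj tree x y × v ∈ bag x × v ∈ bag y) j k → k ∈ S
    exit v∉ j∈S ε = j∈S
    exit v∉ j∈S ((jk , v∈j , _) ◅ path) = exit v∉ (hangs j∈S (λ { refl → v∉ v∈j }) jk) path

    ∧-true : ∀ {a b} → a ∧ not b ≡ true → a ≡ true × b ≡ false
    ∧-true {true} {false} _ = refl , refl

    not-true : ∀ {a} → not a ≡ true → a ≡ false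
    not-true {false} _ = refl

    -- If u and v were adjacent, some bag k would contain both. Coherence for u keeps k in S, so v
    -- would be covered by S.
    separated : ∀ u v → inside u ≡ true → outside v ≡ true → ¬ hamming u v ≤ t
    separated u v u-in v-out u~v
      with find (does-true (covered? S u) (proj₁ (∧-true {inS u} {inBag u} u-in)))
    ... | j , j∈S , u∈j with edge-cov (u≢v , u~v)
      where
      u≢v : u ≢ v
      u≢v refl with () ← trans (sym (not-true v-out)) (proj₁ (∧-true {inS u} {inBag u} u-in))
    ...   | k , u∈k , v∈k = does-false (covered? S v) (not-true v-out) (lose k∈S v∈k)
      where
      k∈S = exit (does-false (u ∈ⱽ? bag i) (proj₂ (∧-true {inS u} {inBag u} u-in))) j∈S (coherent u u∈j u∈k)

two-members : ∀ {A : Set} {x y : A} {l} → x ≢ y → x ∈ l → y ∈ l → 2 ≤ length l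
two-members x≢y (here refl) (here refl)             = contradiction refl x≢y
two-members {l = _ ∷ _ ∷ _} x≢y _ _                 = s≤s (s≤s z≤n)

-- The graph has an edge, so the largest bag has at least two elements and is at most twice the
-- width. This gives 128² = 4096 · 2².
treewidth-lower : ∀ t q n → 1 ≤ t → 2 ≤ q → 1 ≤ n → t * t ≤ n → (D : TreeDecomposition (H t q n)) →
  t * q ^ n * (t * q ^ n) ≤ n * (128 * width D * (128 * width D))
treewidth-lower t (suc zero) n 1≤t (s≤s ())
treewidth-lower t q@(suc (suc _)) n@(suc m) 1≤t 2≤q 1≤n t²≤n D = begin
  t * q ^ n * (t * q ^ n)                             ≤⟨ proj₂ largest ⟩
  4096 * n * (x * x)                                  ≤⟨ *-monoʳ-≤ (4096 * n) (*-mono-≤ x≤2w x≤2w) ⟩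
  4096 * n * (2 * width D * (2 * width D))            ≡⟨ regroup n (width D) ⟩
  n * (128 * width D * (128 * width D))               ∎
  where
  open ≤-Reasoning
  open TreeDecomposition D using (bag; edge-cov; size)
  largest = large-bag 1≤n t²≤n D
  x = length (bag (proj₁ largest))
  lengths = map (λ i → length (bag i)) (allFin size)

  ≤-max : ∀ i → length (bag i) ≤ max 0 lengths
  ≤-max i = All.lookup (xs≤max 0 lengths) (∈-map⁺ _ (∈-allFin i))

  u v : Vec (Fin q) n
  u = replicate n Fin.zero
  v = Fin.suc Fin.zero ∷ replicate m Fin.zero

  edge = edge-cov {u} {v} ((λ ()) , ≤-trans (hamming-head Fin.zero (Fin.suc Fin.zero) (replicate m Fin.zero)) 1≤t)

  2≤max : 2 ≤ max 0 lengths
  2≤max = ≤-trans (two-members {x = u} {v} (λ ()) (proj₁ (proj₂ edge)) (proj₂ (proj₂ edge))) (≤-max (proj₁ edge))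

  doubled : ∀ {m} → 2 ≤ m → m ≤ 2 * (m ∸ 1)
  doubled {suc (suc m)} _ = s≤s (≤-trans (≤-reflexive (+-comm 1 m)) (+-monoʳ-≤ m (s≤s z≤n)))
  doubled {suc zero} (s≤s ())

  x≤2w : x ≤ 2 * width D
  x≤2w = ≤-trans (≤-max _) (doubled 2≤max)

  regroup : ∀ n w → 4096 * n * (2 * w * (2 * w)) ≡ n * (128 * w * (128 * w))
  regroup = solve-∀

-- Sizes of the weight layers

-- layer a b n j = C(n, j) aʲ bⁿ⁻ʲ.
layer : ℕ → ℕ → ℕ → ℕ → ℕ
layer a b zero    zero    = 1
layer a b zero    (suc j) = 0
layer a b (suc n) zero    = b * layer a b n 0
layer a b (suc n) (suc j) = a * layer a b n j + b * layer a b n (suc j)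

layer-vanishes : ∀ a b {n j} → n < j → layer a b n j ≡ 0
layer-vanishes a b {zero}  {suc j} _ = refl
layer-vanishes a b {suc n} {suc j} (s≤s n<j) = begin
  a * layer a b n j + b * layer a b n (suc j) ≡⟨ cong₂ (λ x y → a * x + b * y) (layer-vanishes a b n<j) (layer-vanishes a b (m<n⇒m<1+n n<j)) ⟩
  a * 0 + b * 0                               ≡⟨ cong₂ _+_ (*-zeroʳ a) (*-zeroʳ b) ⟩
  0                                           ∎
  where open ≡-Reasoning

layer-sym : ∀ a b {n} i j → i + j ≡ n → layer a b n i ≡ layer b a n j
layer-sym a b {zero}  zero    zero    _  = refl
layer-sym a b {suc n} zero    (suc j) eq = begin
  b * layer a b n 0                           ≡⟨ cong (b *_) (layer-sym a b 0 j (suc-injective eq)) ⟩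
  b * layer b a n j                           ≡⟨ +-identityʳ _ ⟨
  b * layer b a n j + 0                       ≡⟨ cong (b * layer b a n j +_) (*-zeroʳ a) ⟨
  b * layer b a n j + a * 0                   ≡⟨ cong (λ x → b * layer b a n j + a * x) (layer-vanishes b a (≤-reflexive (sym eq))) ⟨
  b * layer b a n j + a * layer b a n (suc j) ∎
  where open ≡-Reasoning
layer-sym a b {suc n} (suc i) zero    eq = begin
  a * layer a b n i + b * layer a b n (suc i) ≡⟨ cong (λ x → a * layer a b n i + b * x) (layer-vanishes a b (≤-reflexive (trans (sym eq) (+-identityʳ _)))) ⟩
  a * layer a b n i + b * 0                   ≡⟨ cong (a * layer a b n i +_) (*-zeroʳ b) ⟩
  a * layer a b n i + 0                       ≡⟨ +-identityʳ _ ⟩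
  a * layer a b n i                           ≡⟨ cong (a *_) (layer-sym a b i 0 (suc-injective eq)) ⟩
  a * layer b a n 0                           ∎
  where open ≡-Reasoning
layer-sym a b {suc n} (suc i) (suc j) eq = begin
  a * layer a b n i + b * layer a b n (suc i) ≡⟨ cong₂ (λ x y → a * x + b * y) (layer-sym a b i (suc j) (suc-injective eq))
                                                   (layer-sym a b (suc i) j (trans (sym (+-suc i j)) (suc-injective eq))) ⟩
  a * layer b a n (suc j) + b * layer b a n j ≡⟨ +-comm (a * layer b a n (suc j)) _ ⟩
  b * layer b a n j + a * layer b a n (suc j) ∎
  where open ≡-Reasoning

-- This is the ratio of consecutive binomial terms, (n - j) a to (j + 1) b, with the subtracted part
-- moved to the left.
layer-recurrence : ∀ a b n j → suc j * b * layer a b n (suc j) + j * a * layer a b n j ≡ n * a * layer a b n j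
layer-recurrence a b zero    zero    = cong (_+ 0) (*-zeroʳ (1 * b))
layer-recurrence a b zero    (suc j) = cong₂ _+_ (*-zeroʳ (suc (suc j) * b)) (*-zeroʳ (suc j * a))
layer-recurrence a b (suc n) zero    = begin
  1 * b * (a * x + b * y) + 0       ≡⟨ split a b x y ⟩
  a * (b * x) + b * (1 * b * y + 0) ≡⟨ cong (λ z → a * (b * x) + b * z) (layer-recurrence a b n 0) ⟩
  a * (b * x) + b * (n * a * x)     ≡⟨ merge a b n x ⟩
  suc n * a * (b * x)               ∎
  where
  open ≡-Reasoning
  x = layer a b n 0
  y = layer a b n 1
  split : ∀ a b x y → 1 * b * (a * x + b * y) + 0 ≡ a * (b * x) + b * (1 * b * y + 0)
  split = solve-∀
  merge : ∀ a b n x → a * (b * x) + b * (n * a * x) ≡ suc n * a * (b * x)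
  merge = solve-∀
layer-recurrence a b (suc n) (suc k) = begin
  suc (suc k) * b * (a * y + b * z) + suc k * a * (a * x + b * y)
    ≡⟨ split a b k x y z ⟩
  b * (suc (suc k) * b * z + suc k * a * y) + a * (suc k * b * y + k * a * x) + a * (a * x + b * y)
    ≡⟨ cong₂ (λ u v → b * u + a * v + a * (a * x + b * y)) (layer-recurrence a b n (suc k)) (layer-recurrence a b n k) ⟩
  b * (n * a * y) + a * (n * a * x) + a * (a * x + b * y)
    ≡⟨ merge a b n x y ⟩
  suc n * a * (a * x + b * y)
    ∎
  where
  open ≡-Reasoning
  x = layer a b n k
  y = layer a b n (suc k)
  z = layer a b n (suc (suc k))
  split : ∀ a b k x y z → suc (suc k) * b * (a * y + b * z) + suc k * a * (a * x + b * y)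
                        ≡ b * (suc (suc k) * b * z + suc k * a * y) + a * (suc k * b * y + k * a * x) + a * (a * x + b * y)
  split = solve-∀
  merge : ∀ a b n x y → b * (n * a * y) + a * (n * a * x) + a * (a * x + b * y) ≡ suc n * a * (a * x + b * y)
  merge = solve-∀

layers : ℕ → ℕ → ℕ → ℕ → ℕ
layers a b n zero    = 0
layers a b n (suc m) = layers a b n m + layer a b n m

layers-suc : ∀ a b n m → layers a b (suc n) (suc m) ≡ b * layers a b n (suc m) + a * layers a b n m
layers-suc a b n zero    = sym (trans (cong (b * layer a b n 0 +_) (*-zeroʳ a)) (+-identityʳ _))
layers-suc a b n (suc m) = trans (cong (_+ layer a b (suc n) (suc m)) (layers-suc a b n m))
                                 (regroup a b (layers a b n m) (layer a b n m) (layer a b n (suc m)))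
  where
  regroup : ∀ a b s x y → b * (s + x) + a * s + (a * x + b * y) ≡ b * (s + x + y) + a * (s + x)
  regroup = solve-∀

-- A partial sum of the binomial expansion, bounded through Pascal's rule for partial sums.
layers-≤ : ∀ a b n m → layers a b n m ≤ (a + b) ^ n
layers-≤ a b n       zero          = z≤n
layers-≤ a b zero    (suc zero)    = ≤-refl
layers-≤ a b zero    (suc (suc m)) = ≤-trans (≤-reflexive (+-identityʳ _)) (layers-≤ a b zero (suc m))
layers-≤ a b (suc n) (suc m)       = begin
  layers a b (suc n) (suc m)                      ≡⟨ layers-suc a b n m ⟩
  b * layers a b n (suc m) + a * layers a b n m   ≤⟨ +-mono-≤ (*-monoʳ-≤ b (layers-≤ a b n (suc m))) (*-monoʳ-≤ a (layers-≤ a b n m)) ⟩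
  b * (a + b) ^ n + a * (a + b) ^ n               ≡⟨ *-distribʳ-+ ((a + b) ^ n) b a ⟨
  (b + a) * (a + b) ^ n                           ≡⟨ cong (_* (a + b) ^ n) (+-comm b a) ⟩
  (a + b) * (a + b) ^ n                           ∎
  where open ≤-Reasoning

-- Beyond the mode the ratio of the layers k + 1 and k above j is at least
-- (D − k a) / (D + (k + 1) b) with D = (n − j) a, so the loss after k steps is
-- at most the fraction k² (a + b) / D.
slow-decay : ∀ a b i j k → j * b ≤ i * a →
  i * a * layer a b (j + i) j ≤ i * a * layer a b (j + i) (k + j) + k * k * (a + b) * layer a b (j + i) j
slow-decay a b i j zero    jb≤ia = m≤m+n _ _
-- Here x is the layer at j, and y, z are those after k and k + 1 steps. Nothing is lost while z is
-- at least x. With both below x, the loss of this step adds to that of the induction hypothesis.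
-- When the layers cross from y ≥ x to z ≤ x, the term k a y is not bounded by k a x, so the step is
-- estimated directly from D - k a.
slow-decay a b i j (suc k) jb≤ia = conclude (≤-total x z) (≤-total y x)
  where
  open ≤-Reasoning
  n = j + i
  D = i * a
  x = layer a b n j
  y = layer a b n (k + j)
  z = layer a b n (suc k + j)

  growing : x ≤ z → D * x ≤ D * z + suc k * suc k * (a + b) * x
  growing x≤z = ≤-trans (*-monoʳ-≤ D x≤z) (m≤m+n (D * z) _)

  recurrence : (k + j + 1) * b * z + k * a * y ≡ D * y
  recurrence = +-cancelʳ-≡ (j * a * y) _ _ (≡.begin
    (k + j + 1) * b * z + k * a * y + j * a * y ≡.≡⟨ regroup k j a b y z ⟩
    suc (k + j) * b * z + (k + j) * a * y       ≡.≡⟨ layer-recurrence a b n (k + j) ⟩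
    (j + i) * a * y                             ≡.≡⟨ regroup′ i j a y ⟩
    i * a * y + j * a * y                       ≡.∎)
    where
    module ≡ = ≡-Reasoning
    regroup : ∀ k j a b y z → (k + j + 1) * b * z + k * a * y + j * a * y ≡ suc (k + j) * b * z + (k + j) * a * y
    regroup = solve-∀
    regroup′ : ∀ i j a y → (j + i) * a * y ≡ i * a * y + j * a * y
    regroup′ = solve-∀

  next : z ≤ x → (k + j + 1) * b * z ≤ D * z + suc k * b * x
  next z≤x = begin
    (k + j + 1) * b * z              ≡⟨ regroup k j b z ⟩
    j * b * z + suc k * b * z        ≤⟨ +-mono-≤ (*-monoˡ-≤ z jb≤ia) (*-monoʳ-≤ (suc k * b) z≤x) ⟩
    D * z + suc k * b * x            ∎
    where
    regroup : ∀ k j b z → (k + j + 1) * b * z ≡ j * b * z + suc k * b * z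
    regroup = solve-∀

  dropping : z ≤ x → y ≤ x → D * x ≤ D * z + suc k * suc k * (a + b) * x
  dropping z≤x y≤x = begin
    D * x                                                     ≤⟨ slow-decay a b i j k jb≤ia ⟩
    D * y + k * k * (a + b) * x                               ≡⟨ cong (_+ k * k * (a + b) * x) recurrence ⟨
    (k + j + 1) * b * z + k * a * y + k * k * (a + b) * x     ≤⟨ +-monoˡ-≤ (k * k * (a + b) * x) (+-mono-≤ (next z≤x) (*-monoʳ-≤ (k * a) y≤x)) ⟩
    D * z + suc k * b * x + k * a * x + k * k * (a + b) * x   ≤⟨ m≤m+n _ ((suc k * a + k * b) * x) ⟩
    D * z + suc k * b * x + k * a * x + k * k * (a + b) * x + (suc k * a + k * b) * x ≡⟨ collect (D * z) a b k x ⟩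
    D * z + suc k * suc k * (a + b) * x                       ∎
    where
    collect : ∀ w a b k x → w + suc k * b * x + k * a * x + k * k * (a + b) * x + (suc k * a + k * b) * x
                          ≡ w + suc k * suc k * (a + b) * x
    collect = solve-∀

  rebounding : z ≤ x → x ≤ y → D * x ≤ D * z + suc k * suc k * (a + b) * x
  rebounding z≤x x≤y with ≤-total D (k * a)
  ... | inj₁ D≤ka = ≤-trans (*-monoˡ-≤ x (≤-trans D≤ka (*-mono-≤ (≤-trans (n≤1+n k) (m≤m*n (suc k) (suc k))) (m≤m+n a b))))
                            (m≤n+m _ (D * z))
  ... | inj₂ ka≤D = begin
    D * x                                        ≡⟨ cong (_* x) (m∸n+n≡m ka≤D) ⟨
    (r + k * a) * x                              ≡⟨ *-distribʳ-+ x r (k * a) ⟩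
    r * x + k * a * x                            ≤⟨ +-monoˡ-≤ (k * a * x) (*-monoʳ-≤ r x≤y) ⟩
    r * y + k * a * x                            ≡⟨ cong (_+ k * a * x) ry ⟨
    (k + j + 1) * b * z + k * a * x              ≤⟨ +-monoˡ-≤ (k * a * x) (next z≤x) ⟩
    D * z + suc k * b * x + k * a * x            ≤⟨ m≤m+n _ ((k * suc k * (a + b) + a) * x) ⟩
    D * z + suc k * b * x + k * a * x + (k * suc k * (a + b) + a) * x
                                                 ≡⟨ collect (D * z) a b k x ⟩
    D * z + suc k * suc k * (a + b) * x          ∎
    where
    collect : ∀ w a b k x → w + suc k * b * x + k * a * x + (k * suc k * (a + b) + a) * x
                          ≡ w + suc k * suc k * (a + b) * x
    collect = solve-∀
    r = D ∸ k * a
    ry : (k + j + 1) * b * z ≡ r * y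
    ry = +-cancelʳ-≡ (k * a * y) _ _ (trans recurrence
      (trans (cong (_* y) (sym (m∸n+n≡m ka≤D))) (*-distribʳ-+ y r (k * a))))

  conclude : x ≤ z ⊎ z ≤ x → y ≤ x ⊎ x ≤ y → D * x ≤ D * z + suc k * suc k * (a + b) * x
  conclude (inj₁ x≤z) _          = growing x≤z
  conclude (inj₂ z≤x) (inj₁ y≤x) = dropping z≤x y≤x
  conclude (inj₂ z≤x) (inj₂ x≤y) = rebounding z≤x x≤y

-- Balanced halves give D ≥ n(a + b)/6, so 12K² ≤ n keeps the loss in `slow-decay` to at most one
-- half for all k ≤ K. The K layers from j upwards, each at least half of the one at j, have total
-- size at most (a + b)ⁿ.
layer-half : ∀ a b i j K → 1 ≤ a → 1 ≤ b → 1 ≤ j + i → (a + b) * (a + b) ≤ 6 * (a * b) → 12 * (K * K) ≤ j + i → j * b ≤ i * a →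
  K * layer a b (j + i) j ≤ 2 * (a + b) ^ (j + i)
layer-half a b i j K 1≤a 1≤b 1≤n balanced-halves 12K²≤n jb≤ia =
  ≤-trans (accumulate K ≤-refl) (*-monoʳ-≤ 2 (layers-≤ a b n (K + j)))
  where
  open ≤-Reasoning
  n = j + i
  D = i * a
  q = a + b
  x = layer a b n j

  nq≤6D : n * q ≤ 6 * D
  nq≤6D = *-cancelʳ-≤ _ _ q {{≢-nonZero (λ q≡0 → contradiction (≤-trans (≤-trans 1≤a (m≤m+n a b)) (≤-reflexive q≡0)) λ ())}} (begin
    n * q * q                         ≡⟨ *-assoc n q q ⟩
    n * (q * q)                       ≤⟨ *-monoʳ-≤ n balanced-halves ⟩
    n * (6 * (a * b))                 ≡⟨ split i j a b ⟩
    6 * (j * b * a + i * a * b)       ≤⟨ *-monoʳ-≤ 6 (+-monoˡ-≤ (i * a * b) (*-monoˡ-≤ a jb≤ia)) ⟩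
    6 * (i * a * a + i * a * b)       ≡⟨ cong (6 *_) (*-distribˡ-+ (i * a) a b) ⟨
    6 * (D * q)                       ≡⟨ *-assoc 6 D q ⟨
    6 * D * q                         ∎)
    where
    split : ∀ i j a b → (j + i) * (6 * (a * b)) ≡ 6 * (j * b * a + i * a * b)
    split = solve-∀

  D≢0 : NonZero D
  D≢0 = ≢-nonZero (λ D≡0 → contradiction
    (≤-trans (*-mono-≤ 1≤n (≤-trans 1≤a (m≤m+n a b))) (≤-trans nq≤6D (≤-reflexive (cong (6 *_) D≡0)))) λ ())

  half : ∀ k → k ≤ K → x ≤ 2 * layer a b n (k + j)
  half k k≤K = *-cancelˡ-≤ D {{D≢0}} (+-cancelʳ-≤ (D * x) _ _ (begin
    D * x + D * x                                   ≤⟨ +-mono-≤ (slow-decay a b i j k jb≤ia) (slow-decay a b i j k jb≤ia) ⟩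
    D * y + k * k * q * x + (D * y + k * k * q * x) ≡⟨ regroup D k q x y ⟩
    D * (2 * y) + 2 * (k * k * q) * x               ≤⟨ +-monoʳ-≤ (D * (2 * y)) (*-monoˡ-≤ x small) ⟩
    D * (2 * y) + D * x                             ∎))
    where
    y = layer a b n (k + j)
    small : 2 * (k * k * q) ≤ D
    small = *-cancelˡ-≤ 6 (begin
      6 * (2 * (k * k * q))   ≡⟨ collect k q ⟩
      12 * (k * k) * q        ≤⟨ *-monoˡ-≤ q (≤-trans (*-monoʳ-≤ 12 (*-mono-≤ k≤K k≤K)) 12K²≤n) ⟩
      n * q                   ≤⟨ nq≤6D ⟩
      6 * D                   ∎)
      where
      collect : ∀ k q → 6 * (2 * (k * k * q)) ≡ 12 * (k * k) * q
      collect = solve-∀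
    regroup : ∀ D k q x y → D * y + k * k * q * x + (D * y + k * k * q * x) ≡ D * (2 * y) + 2 * (k * k * q) * x
    regroup = solve-∀

  accumulate : ∀ m → m ≤ K → m * x ≤ 2 * layers a b n (m + j)
  accumulate zero    _   = z≤n
  accumulate (suc m) m<K = begin
    x + m * x                                               ≤⟨ +-mono-≤ (half m (<⇒≤ m<K)) (accumulate m (<⇒≤ m<K)) ⟩
    2 * layer a b n (m + j) + 2 * layers a b n (m + j)      ≡⟨ +-comm (2 * layer a b n (m + j)) _ ⟩
    2 * layers a b n (m + j) + 2 * layer a b n (m + j)      ≡⟨ *-distribˡ-+ 2 (layers a b n (m + j)) (layer a b n (m + j)) ⟨
    2 * (layers a b n (m + j) + layer a b n (m + j))        ∎

-- For j above the mean, exchanging a and b replaces j by n - j, which lies below the new mean.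
layer-bound : ∀ a b n j K → 1 ≤ a → 1 ≤ b → 1 ≤ n → (a + b) * (a + b) ≤ 6 * (a * b) → 12 * (K * K) ≤ n →
  K * layer a b n j ≤ 2 * (a + b) ^ n
layer-bound a b n j K 1≤a 1≤b 1≤n balanced-halves 12K²≤n with <-≤-connex n j
... | inj₁ n<j = ≤-trans (≤-reflexive (trans (cong (K *_) (layer-vanishes a b n<j)) (*-zeroʳ K))) z≤n
... | inj₂ j≤n = subst (λ n → K * layer a b n j ≤ 2 * (a + b) ^ n) j+i≡n
  ([ layer-half a b i j K 1≤a 1≤b 1≤j+i balanced-halves 12K²≤j+i , flipped ]′ (≤-total (j * b) (i * a)))
  where
  open ≤-Reasoning
  i = n ∸ j
  j+i≡n = m+[n∸m]≡n j≤n
  1≤j+i = ≤-trans 1≤n (≤-reflexive (sym j+i≡n))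
  12K²≤j+i = ≤-trans 12K²≤n (≤-reflexive (sym j+i≡n))

  flipped : i * a ≤ j * b → K * layer a b (j + i) j ≤ 2 * (a + b) ^ (j + i)
  flipped ia≤jb = begin
    K * layer a b (j + i) j   ≡⟨ cong (K *_) (layer-sym a b j i refl) ⟩
    K * layer b a (j + i) i   ≡⟨ cong (λ n → K * layer b a n i) (+-comm j i) ⟩
    K * layer b a (i + j) i   ≤⟨ layer-half b a j i K 1≤b 1≤a (≤-trans 1≤j+i (≤-reflexive (+-comm j i)))
                                   (≤-trans (≤-reflexive (cong (λ q → q * q) (+-comm b a))) (≤-trans balanced-halves (≤-reflexive (cong (6 *_) (*-comm a b)))))
                                   (≤-trans 12K²≤j+i (≤-reflexive (+-comm j i))) ia≤jb ⟩
    2 * (b + a) ^ (i + j)     ≡⟨ cong₂ (λ q n → 2 * q ^ n) (+-comm b a) (+-comm i j) ⟩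
    2 * (a + b) ^ (j + i)     ∎

-- The path decomposition by weight

bit-does-mono : ∀ {P Q : Set} (P? : Dec P) (Q? : Dec Q) → (P → Q) → bit (does P?) ≤ bit (does Q?)
bit-does-mono (no _)  _       _  = z≤n
bit-does-mono (yes _) (yes _) _  = ≤-refl
bit-does-mono (yes p) (no ¬q) pq = contradiction (pq p) ¬q

PathAdj : ∀ {m} → Fin m → Fin m → Set
PathAdj i j = suc (toℕ i) ≡ toℕ j ⊎ suc (toℕ j) ≡ toℕ i

path : ∀ m → Graph (Fin m)
path m = record
  { Adj        = PathAdj
  ; adj?       = λ i j → (suc (toℕ i) ≟ toℕ j) ⊎-dec (suc (toℕ j) ≟ toℕ i)
  ; adj-sym    = Sum.swap
  ; adj-irrefl = λ { refl → [ 1+n≢n , 1+n≢n ]′ }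
  }

path-interval : ∀ {m} {P : Fin m → Set} d i j → d + toℕ i ≡ toℕ j → (∀ k → toℕ i ≤ toℕ k → toℕ k ≤ toℕ j → P k) →
  Star (λ a b → PathAdj a b × P a × P b) i j
path-interval zero    i j eq P with refl ← toℕ-injective {i = i} {j} eq = ε
path-interval {m} (suc d) i j eq P =
  (inj₁ (sym i′≡) , P i ≤-refl i≤j , P i′ (≤-trans (n≤1+n _) (≤-reflexive (sym i′≡))) i′≤j) ◅
  path-interval d i′ j d+i′≡j (λ k i′≤k → P k (≤-trans (n≤1+n _) (≤-trans (≤-reflexive (sym i′≡)) i′≤k)))
  where
  1+i≤j : suc (toℕ i) ≤ toℕ j
  1+i≤j = ≤-trans (s≤s (m≤n+m (toℕ i) d)) (≤-reflexive eq)
  i≤j = ≤-trans (n≤1+n (toℕ i)) 1+i≤j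
  1+i<m = ≤-<-trans 1+i≤j (toℕ<n j)
  i′ : Fin m
  i′ = fromℕ< 1+i<m
  i′≡ : toℕ i′ ≡ suc (toℕ i)
  i′≡ = toℕ-fromℕ< 1+i<m
  i′≤j = ≤-trans (≤-reflexive i′≡) 1+i≤j
  d+i′≡j : d + toℕ i′ ≡ toℕ j
  d+i′≡j = trans (cong (d +_) i′≡) (trans (+-suc d (toℕ i)) eq)

path-convex : ∀ {m} (P : Fin m → Set) → (∀ {i k j} → toℕ i ≤ toℕ k → toℕ k ≤ toℕ j → P i → P j → P k) →
  ConnectedOn (path m) P
path-convex P convex {i} {j} Pi Pj with ≤-total (toℕ i) (toℕ j)
... | inj₁ i≤j = path-interval (toℕ j ∸ toℕ i) i j (m∸n+n≡m i≤j) (λ k i≤k k≤j → convex i≤k k≤j Pi Pj)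
... | inj₂ j≤i = Star.reverse (λ (ab , Pa , Pb) → Sum.swap ab , Pb , Pa)
  (path-interval (toℕ i ∸ toℕ j) j i (m∸n+n≡m j≤i) (λ k j≤k k≤i → convex j≤k k≤i Pj Pi))

-- Distinctness forbids turning back, so the walk climbs until its last edge, the one to w, which
-- may descend by one.
ascending : ∀ {m} {x y w : Fin m} ys → suc (toℕ x) ≡ toℕ y → Unique (x ∷ y ∷ ys) → Linked PathAdj (y ∷ ys ∷ʳ w) →
  toℕ y ≤ suc (toℕ w)
ascending []       _   _ (inj₁ y<w ∷ _) = ≤-trans (n≤1+n _) (≤-trans (≤-reflexive y<w) (n≤1+n _))
ascending []       _   _ (inj₂ w<y ∷ _) = ≤-reflexive (sym w<y)
ascending (z ∷ zs) x<y (_ ∷ uniq) (inj₁ y<z ∷ linked) =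
  ≤-trans (n≤1+n _) (≤-trans (≤-reflexive y<z) (ascending zs y<z uniq linked))
ascending (z ∷ zs) x<y ((_ ∷ x≢z ∷ _) ∷ _) (inj₂ z<y ∷ _) =
  contradiction (toℕ-injective (suc-injective (trans x<y (sym z<y)))) x≢z

descending : ∀ {m} {x y w : Fin m} ys → suc (toℕ y) ≡ toℕ x → Unique (x ∷ y ∷ ys) → Linked PathAdj (y ∷ ys ∷ʳ w) →
  toℕ w ≤ suc (toℕ y)
descending []       _   _ (inj₁ y<w ∷ _) = ≤-reflexive (sym y<w)
descending []       _   _ (inj₂ w<y ∷ _) = ≤-trans (n≤1+n _) (≤-trans (≤-reflexive w<y) (n≤1+n _))
descending (z ∷ zs) y<x (_ ∷ uniq) (inj₂ z<y ∷ linked) =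
  ≤-trans (descending zs z<y uniq linked) (≤-trans (≤-reflexive z<y) (n≤1+n _))
descending (z ∷ zs) y<x ((_ ∷ x≢z ∷ _) ∷ _) (inj₁ y<z ∷ _) =
  contradiction (toℕ-injective (trans (sym y<x) y<z)) x≢z

path-acyclic : ∀ {m} (x : Fin m) xs → ¬ IsCycle (path m) x xs
path-acyclic x []           (s≤s () , _)
path-acyclic x (y ∷ [])     (s≤s (s≤s ()) , _)
path-acyclic x (y ∷ z ∷ zs) (_ , (_ ∷ x≢z ∷ _) ∷ _ , inj₁ x<y ∷ inj₂ z<y ∷ _) =
  x≢z (toℕ-injective (suc-injective (trans x<y (sym z<y))))
path-acyclic x (y ∷ z ∷ zs) (_ , (_ ∷ x≢z ∷ _) ∷ _ , inj₂ y<x ∷ inj₁ y<z ∷ _) =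
  x≢z (toℕ-injective (trans (sym y<x) y<z))
path-acyclic x (y ∷ z ∷ zs) (_ , _ ∷ uniq , inj₁ x<y ∷ inj₁ y<z ∷ linked) =
  1+n≰n (≤-trans (≤-reflexive (trans (cong suc x<y) y<z)) (ascending zs y<z uniq linked))
path-acyclic x (y ∷ z ∷ zs) (_ , _ ∷ uniq , inj₂ y<x ∷ inj₂ z<y ∷ linked) =
  1+n≰n (≤-trans (≤-reflexive (trans (cong suc z<y) y<x)) (descending zs z<y uniq linked))

path-isTree : ∀ m → IsTree (path (suc m))
path-isTree m = record
  { root      = Fin.zero
  ; connected = λ i j → Star.map proj₁ (path-convex (λ _ → ⊤) (λ _ _ _ _ → tt) {i} {j} tt tt)
  ; acyclic   = path-acyclic
  }

-- The symbols of even index. Alternation lets the sizes of the two halves follow the recursion on q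
-- without division.
low : ∀ {q} → Fin q → Bool
low Fin.zero    = true
low (Fin.suc c) = not (low c)

-- ⌈q/2⌉ and ⌊q/2⌋, defined along the recursion of low.
lows highs : ℕ → ℕ
lows  zero    = 0
lows  (suc q) = suc (highs q)
highs zero    = 0
highs (suc q) = lows q

sum-low : ∀ q x y → sum {q} (λ c → if low c then x else y) ≡ lows q * x + highs q * y
sum-low zero    x y = refl
sum-low (suc q) x y = begin
  x + sum {q} (λ c → if not (low c) then x else y) ≡⟨ cong (x +_) (sum-cong-≗ {q} (λ c → if-not (low c))) ⟩
  x + sum {q} (λ c → if low c then y else x)       ≡⟨ cong (x +_) (sum-low q y x) ⟩
  x + (lows q * y + highs q * x)                   ≡⟨ regroup (lows q) (highs q) x y ⟩
  suc (highs q) * x + lows q * y                   ∎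
  where
  open ≡-Reasoning
  if-not : ∀ b → (if not b then x else y) ≡ (if b then y else x)
  if-not true  = refl
  if-not false = refl
  regroup : ∀ l h x y → x + (l * y + h * x) ≡ suc h * x + l * y
  regroup = solve-∀

lows+highs : ∀ q → lows q + highs q ≡ q
lows+highs zero    = refl
lows+highs (suc q) = cong suc (trans (+-comm (highs q) _) (lows+highs q))

lows-even-odd : ∀ q → lows q ≡ highs q ⊎ lows q ≡ suc (highs q)
lows-even-odd zero    = inj₁ refl
lows-even-odd (suc q) with lows-even-odd q
... | inj₁ eq = inj₂ (cong suc (sym eq))
... | inj₂ eq = inj₁ (sym eq)

1≤lows : ∀ q → 2 ≤ q → 1 ≤ lows q
1≤lows (suc q) _ = s≤s z≤n

1≤highs : ∀ q → 2 ≤ q → 1 ≤ highs q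
1≤highs (suc zero) (s≤s ())
1≤highs (suc (suc q)) _ = s≤s z≤n

-- The ratio of the square of the sum to the product is 4 for even q and at most 9/2, its value at q
-- = 3, for odd q.
halves-balanced : ∀ q → 2 ≤ q → (lows q + highs q) * (lows q + highs q) ≤ 6 * (lows q * highs q)
halves-balanced q 2≤q with lows q | highs q | lows-even-odd q | 1≤highs q 2≤q
... | a | b | inj₁ refl | 1≤b = ≤-trans (m≤m+n _ (2 * (b * b))) (≤-reflexive (collect b))
  where
  collect : ∀ b → (b + b) * (b + b) + 2 * (b * b) ≡ 6 * (b * b)
  collect = solve-∀
... | _ | suc b | inj₂ refl | _ = ≤-trans (m≤m+n _ (2 * b * b + 6 * b + 3)) (≤-reflexive (collect b))
  where
  collect : ∀ b → (suc (suc b) + suc b) * (suc (suc b) + suc b) + (2 * b * b + 6 * b + 3) ≡ 6 * (suc (suc b) * suc b)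
  collect = solve-∀

weight : ∀ {q n} → Vec (Fin q) n → ℕ
weight []      = 0
weight (c ∷ v) = if low c then suc (weight v) else weight v

weight-≤ : ∀ {q n} (v : Vec (Fin q) n) → weight v ≤ n
weight-≤ []      = z≤n
weight-≤ (c ∷ v) with low c
... | true  = s≤s (weight-≤ v)
... | false = m≤n⇒m≤1+n (weight-≤ v)

-- A differing coordinate changes the weight by at most one. So the t + 1 weights from the smaller
-- one upwards catch both ends of an edge.
weight-hamming : ∀ {q n} (u v : Vec (Fin q) n) → weight v ≤ weight u + hamming u v
weight-hamming []      []      = z≤n
weight-hamming (a ∷ u) (b ∷ v) with a ≟ᶠ b
weight-hamming (a ∷ u) (b ∷ v) | yes refl with low a
... | true  = s≤s (weight-hamming u v)
... | false = weight-hamming u v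
weight-hamming (a ∷ u) (b ∷ v) | no _ =
  ≤-trans (≤-trans (at-most (low b)) (s≤s (weight-hamming u v)))
          (≤-trans (≤-reflexive (sym (+-suc (weight u) _))) (+-monoˡ-≤ _ (at-least (low a))))
  where
  at-most : ∀ l {w} → (if l then suc w else w) ≤ suc w
  at-most true  = ≤-refl
  at-most false = n≤1+n _
  at-least : ∀ l {w} → w ≤ (if l then suc w else w)
  at-least true  = n≤1+n _
  at-least false = ≤-refl

-- The Boolean test reduces on successors, so each section is counted by a layer of the smaller
-- cube; `sum-low` groups the sections by the half of their head.
card-layer : ∀ {q} n j → card {q} {n} (λ v → weight v ≡ᵇ j) ≡ layer (lows q) (highs q) n j
card-layer zero    zero    = refl
card-layer zero    (suc j) = refl
card-layer {q} (suc n) zero    = begin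
  sum {q} (λ c → card {q} {n} (λ v → weight (c ∷ v) ≡ᵇ 0))              ≡⟨ sum-cong-≗ slice ⟩
  sum {q} (λ c → if low c then 0 else layer a b n 0)        ≡⟨ sum-low q 0 (layer a b n 0) ⟩
  a * 0 + b * layer a b n 0                                 ≡⟨ cong (_+ b * layer a b n 0) (*-zeroʳ a) ⟩
  b * layer a b n 0                                         ∎
  where
  open ≡-Reasoning
  a = lows q
  b = highs q
  slice : ∀ (c : Fin q) → card {q} {n} (λ v → weight (c ∷ v) ≡ᵇ 0) ≡ (if low c then 0 else layer a b n 0)
  slice c with low c
  ... | true  = card-false {q} {n}
  ... | false = card-layer n zero
card-layer {q} (suc n) (suc j) = begin
  sum {q} (λ c → card {q} {n} (λ v → weight (c ∷ v) ≡ᵇ suc j))                     ≡⟨ sum-cong-≗ slice ⟩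
  sum {q} (λ c → if low c then layer a b n j else layer a b n (suc j)) ≡⟨ sum-low q (layer a b n j) (layer a b n (suc j)) ⟩
  a * layer a b n j + b * layer a b n (suc j)                          ∎
  where
  open ≡-Reasoning
  a = lows q
  b = highs q
  slice : ∀ (c : Fin q) → card {q} {n} (λ v → weight (c ∷ v) ≡ᵇ suc j) ≡ (if low c then layer a b n j else layer a b n (suc j))
  slice c with low c
  ... | true  = card-layer n j
  ... | false = card-layer n (suc j)

length-filter-map : ∀ {A B : Set} {P : B → Set} (P? : Decidable P) (f : A → B) xs →
  length (filter P? (map f xs)) ≡ length (filter (P? ∘ f) xs)
length-filter-map P? f []       = refl
length-filter-map P? f (x ∷ xs) with P? (f x)
... | yes _ = cong suc (length-filter-map P? f xs)
... | no _  = length-filter-map P? f xs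

length-filter-vectors : ∀ {q n} {P : Vec (Fin q) n → Set} (P? : Decidable P) →
  length (filter P? (vectors q n)) ≡ card (does ∘ P?)
length-filter-vectors {n = zero} P? with P? []
... | yes _ = refl
... | no _  = refl
length-filter-vectors {q} {suc n} P? = trans (by-heads q (λ c → c)) (sum-cong-≗ (λ c → length-filter-vectors (P? ∘ (c ∷_))))
  where
  by-heads : ∀ m (g : Fin m → Fin q) → length (filter P? (cartesianProductWith _∷_ (tabulate g) (vectors q n)))
                                     ≡ sum (λ c → length (filter (P? ∘ (g c ∷_)) (vectors q n)))
  by-heads zero    g = refl
  by-heads (suc m) g = begin
    length (filter P? (map (g Fin.zero ∷_) vs ++ rest))                   ≡⟨ cong length (filter-++ P? (map (g Fin.zero ∷_) vs) rest) ⟩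
    length (filter P? (map (g Fin.zero ∷_) vs) ++ filter P? rest)         ≡⟨ length-++ (filter P? (map (g Fin.zero ∷_) vs)) ⟩
    length (filter P? (map (g Fin.zero ∷_) vs)) + length (filter P? rest) ≡⟨ cong₂ _+_ (length-filter-map P? (g Fin.zero ∷_) vs) (by-heads m (g ∘ Fin.suc)) ⟩
    length (filter (P? ∘ (g Fin.zero ∷_)) vs) + sum (λ c → length (filter (P? ∘ (g (Fin.suc c) ∷_)) vs)) ∎
    where
    open ≡-Reasoning
    vs = vectors q n
    rest = cartesianProductWith _∷_ (tabulate (g ∘ Fin.suc)) vs

module _ (t q n : ℕ) where
  Near : ℕ → ℕ → Vec (Fin q) n → Set
  Near r i v = i ≤ weight v × weight v ≤ r + i

  near? : ∀ r i → Decidable (Near r i)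
  near? r i v = (i ≤? weight v) ×-dec (weight v ≤? r + i)

  layerBag : ∀ r → ℕ → List (Vec (Fin q) n)
  layerBag r i = filter (near? r i) (vectors q n)

  ∈-layerBag : ∀ {r i v} → Near r i v → v ∈ layerBag r i
  ∈-layerBag {r} {i} {v} = ∈-filter⁺ (near? r i) (∈-vectors v)

  near : ∀ {r i v} → v ∈ layerBag r i → Near r i v
  near {r} {i} v∈ = proj₂ (∈-filter⁻ (near? r i) {xs = vectors q n} v∈)

  index : (v : Vec (Fin q) n) → Fin (suc n)
  index v = fromℕ< (s≤s (weight-≤ v))

  toℕ-index : ∀ v → toℕ (index v) ≡ weight v
  toℕ-index v = toℕ-fromℕ< (s≤s (weight-≤ v))

  ∈-bag-index : ∀ {u v} → weight u ≤ weight v → weight v ≤ t + weight u → v ∈ layerBag t (toℕ (index u))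
  ∈-bag-index {u} u≤v v≤ = ∈-layerBag
    ( ≤-trans (≤-reflexive (toℕ-index u)) u≤v
    , ≤-trans v≤ (≤-reflexive (cong (t +_) (sym (toℕ-index u)))))

  common-bag : ∀ {u v} → weight u ≤ weight v → hamming u v ≤ t →
               u ∈ layerBag t (toℕ (index u)) × v ∈ layerBag t (toℕ (index u))
  common-bag {u} {v} u≤v u~v =
    ∈-bag-index {u} {u} ≤-refl (m≤n+m _ t) ,
    ∈-bag-index {u} {v} u≤v (≤-trans (weight-hamming u v) (≤-trans (+-monoʳ-≤ (weight u) u~v) (≤-reflexive (+-comm _ t))))

  edge-covered : ∀ {u v} → hamming u v ≤ t → ∃[ i ] (u ∈ layerBag t (toℕ {suc n} i) × v ∈ layerBag t (toℕ i))
  edge-covered {u} {v} u~v with ≤-total (weight u) (weight v)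
  ... | inj₁ u≤v = index u , common-bag u≤v u~v
  ... | inj₂ v≤u = index v , Product.swap (common-bag v≤u (≤-trans (≤-reflexive (hamming-sym v u)) u~v))

  -- The weights 0, ..., n index the n + 1 bags. Those containing v have indices from weight v - t
  -- to weight v, an interval of the path.
  layer-decomposition : TreeDecomposition (H t q n)
  layer-decomposition = record
    { size       = suc n
    ; tree       = path (suc n)
    ; isTree     = path-isTree n
    ; bag        = λ i → layerBag t (toℕ i)
    ; bag-unique = λ i → filter⁺ (near? t (toℕ i)) (vectors-unique q n)
    ; vertex-cov = λ v → index v , ∈-bag-index {v} {v} ≤-refl (m≤n+m _ t)
    ; edge-cov   = λ (_ , u~v) → edge-covered u~v
    ; coherent   = λ v → path-convex _ λ i≤k k≤j v∈i v∈j →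
        ∈-layerBag (≤-trans k≤j (proj₁ (near v∈j)) , ≤-trans (proj₂ (near v∈i)) (+-monoʳ-≤ t i≤k))
    }

  module _ (K M : ℕ) (bound : ∀ j → K * layer (lows q) (highs q) n j ≤ M) where
    layer-≤ : ∀ j → K * card {q} {n} (λ v → weight v ≡ᵇ j) ≤ M
    layer-≤ j = ≤-trans (≤-reflexive (cong (K *_) (card-layer n j))) (bound j)

    card-near : ∀ r i → K * card (does ∘ near? r i) ≤ suc r * M
    card-near zero    i = ≤-trans (*-monoʳ-≤ K (card-mono equal)) (≤-trans (layer-≤ i) (≤-reflexive (sym (+-identityʳ M))))
      where
      equal : ∀ v → bit (does (near? 0 i v)) ≤ bit (weight v ≡ᵇ i)
      equal v = bit-does-mono (near? 0 i v) (weight v ≟ i) (λ (i≤ , ≤i) → ≤-antisym ≤i i≤)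
    card-near (suc r) i = begin
      K * card (does ∘ near? (suc r) i)                                  ≤⟨ *-monoʳ-≤ K (card-≤-+ {f = does ∘ near? (suc r) i} split) ⟩
      K * (card top + card (does ∘ near? r i))                           ≡⟨ *-distribˡ-+ K (card top) _ ⟩
      K * card top + K * card (does ∘ near? r i)                         ≤⟨ +-mono-≤ (layer-≤ (suc r + i)) (card-near r i) ⟩
      M + suc r * M                                                      ∎
      where
      open ≤-Reasoning
      top : Vec (Fin q) n → Bool
      top v = weight v ≡ᵇ suc r + i
      split : ∀ v → bit (does (near? (suc r) i v)) ≤ bit (top v) + bit (does (near? r i v))
      split v = bit-does (near? (suc r) i v) (weight v ≟ suc r + i) (near? r i v) λ (i≤ , ≤sr) →
        [ (λ w< → inj₂ (i≤ , ≤-pred w<)) , inj₁ ]′ (m≤n⇒m<n∨m≡n ≤sr)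

    layer-width : K * width layer-decomposition ≤ suc t * M
    layer-width = ≤-trans (*-monoʳ-≤ K (m∸n≤m _ 1))
      (argmax-all (λ m → m) {P = λ m → K * m ≤ suc t * M} (≤-trans (≤-reflexive (*-zeroʳ K)) z≤n)
        (map⁺ (All.universal bag-≤ (allFin (suc n)))))
      where
      bag-≤ : ∀ i → K * length (layerBag t (toℕ i)) ≤ suc t * M
      bag-≤ i = ≤-trans (≤-reflexive (cong (K *_) (length-filter-vectors (near? t (toℕ i))))) (card-near t (toℕ i))

-- K is the integer part of √(n/12), the number of layers that `layer-bound` can compare. The upper
-- estimate keeps K of order √n.
root-approximation : ∀ n → ∃[ K ] 12 * (K * K) ≤ n × n < 12 * (suc K * suc K)
root-approximation zero = 0 , z≤n , s≤s z≤n
root-approximation (suc n) with root-approximation n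
... | K , K²≤n , n<K with <-≤-connex (suc n) (12 * (suc K * suc K))
...   | inj₁ sn< = K , m≤n⇒m≤1+n K²≤n , sn<
...   | inj₂ K≤sn = suc K , K≤sn , ≤-<-trans n<K (*-monoʳ-< 12 (*-mono-< (n<1+n (suc K)) (n<1+n (suc K))))

-- From 12 ≤ n follows K ≥ 1, hence K + 1 ≤ 2K and n ≤ 48K². With t + 1 ≤ 2t, a bag gives Kw ≤ 4tqⁿ,
-- and 48 · 16 = 768 ≤ 28².
treewidth-upper : ∀ t q n → 1 ≤ t → 2 ≤ q → 12 ≤ n →
  let w = width (layer-decomposition t q n) in n * (w * w) ≤ 28 * (t * q ^ n) * (28 * (t * q ^ n))
treewidth-upper t q n 1≤t 2≤q 12≤n with root-approximation n
... | zero      , _       , n<12 = contradiction (≤-trans n<12 12≤n) 1+n≰n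
... | K@(suc k) , 12K²≤n , n<   = begin
  n * (w * w)                                      ≤⟨ *-monoˡ-≤ (w * w) n≤48K² ⟩
  48 * (K * K) * (w * w)                           ≡⟨ regroup K w ⟩
  48 * (K * w * (K * w))                           ≤⟨ *-monoʳ-≤ 48 (*-mono-≤ Kw≤ Kw≤) ⟩
  48 * (4 * (t * q ^ n) * (4 * (t * q ^ n)))       ≤⟨ m≤m+n _ (16 * (t * q ^ n * (t * q ^ n))) ⟩
  48 * (4 * (t * q ^ n) * (4 * (t * q ^ n))) + 16 * (t * q ^ n * (t * q ^ n)) ≡⟨ collect (t * q ^ n) ⟩
  28 * (t * q ^ n) * (28 * (t * q ^ n))            ∎
  where
  open ≤-Reasoning
  w = width (layer-decomposition t q n)

  n≤48K² : n ≤ 48 * (K * K)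
  n≤48K² = begin
    n                          ≤⟨ <⇒≤ n< ⟩
    12 * (suc K * suc K)       ≤⟨ *-monoʳ-≤ 12 (*-mono-≤ 1+K≤2K 1+K≤2K) ⟩
    12 * (2 * K * (2 * K))     ≡⟨ quadruple K ⟩
    48 * (K * K)               ∎
    where
    1+K≤2K : suc K ≤ 2 * K
    1+K≤2K = +-mono-≤ (s≤s z≤n) (≤-reflexive (sym (+-identityʳ K)))
    quadruple : ∀ K → 12 * (2 * K * (2 * K)) ≡ 48 * (K * K)
    quadruple = solve-∀

  bound : ∀ j → K * layer (lows q) (highs q) n j ≤ 2 * q ^ n
  bound j = ≤-trans
    (layer-bound (lows q) (highs q) n j K (1≤lows q 2≤q) (1≤highs q 2≤q) (≤-trans (s≤s z≤n) 12≤n) (halves-balanced q 2≤q) 12K²≤n)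
    (≤-reflexive (cong (λ q → 2 * q ^ n) (lows+highs q)))

  Kw≤ : K * w ≤ 4 * (t * q ^ n)
  Kw≤ = begin
    K * w                      ≤⟨ layer-width t q n K (2 * q ^ n) bound ⟩
    suc t * (2 * q ^ n)        ≤⟨ *-monoˡ-≤ (2 * q ^ n) (+-monoˡ-≤ t 1≤t) ⟩
    (t + t) * (2 * q ^ n)      ≡⟨ double t (q ^ n) ⟩
    4 * (t * q ^ n)            ∎
    where
    double : ∀ t N → (t + t) * (2 * N) ≡ 4 * (t * N)
    double = solve-∀

  regroup : ∀ K w → 48 * (K * K) * (w * w) ≡ 48 * (K * w * (K * w))
  regroup = solve-∀
  collect : ∀ x → 48 * (4 * x * (4 * x)) + 16 * (x * x) ≡ 28 * x * (28 * x)
  collect = solve-∀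

-- Rational constants

ℕ→ℚ-* : ∀ a b → ℕ→ℚ (a * b) ≡ ℕ→ℚ a ℚ.* ℕ→ℚ b
ℕ→ℚ-* a b = ℚ.toℚᵘ-injective (begin
  ℚ.toℚᵘ (ℕ→ℚ (a * b))                 ≈⟨ ℚ.toℚᵘ-fromℚᵘ (ℚᵘ.mkℚᵘ (ℤ.+ (a * b)) 0) ⟩
  ℚᵘ.mkℚᵘ (ℤ.+ (a * b)) 0                ≈⟨ ℚᵘ.*≡* (cong (ℤ._* ℤ.+ 1) (ℤ.pos-* a b)) ⟩
  ℚᵘ.mkℚᵘ (ℤ.+ a) 0 ℚᵘ.* ℚᵘ.mkℚᵘ (ℤ.+ b) 0 ≈⟨ ℚᵘ.*-cong (ℚ.toℚᵘ-fromℚᵘ (ℚᵘ.mkℚᵘ (ℤ.+ a) 0)) (ℚ.toℚᵘ-fromℚᵘ (ℚᵘ.mkℚᵘ (ℤ.+ b) 0)) ⟨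
  ℚ.toℚᵘ (ℕ→ℚ a) ℚᵘ.* ℚ.toℚᵘ (ℕ→ℚ b)   ≈⟨ ℚ.toℚᵘ-homo-* (ℕ→ℚ a) (ℕ→ℚ b) ⟨
  ℚ.toℚᵘ (ℕ→ℚ a ℚ.* ℕ→ℚ b)             ∎)
  where open ℚᵘ.≃-Reasoning

ℕ→ℚ-mono : ∀ {a b} → a ≤ b → ℕ→ℚ a ℚ.≤ ℕ→ℚ b
ℕ→ℚ-mono {a} {b} a≤b = ℚ.toℚᵘ-cancel-≤ (begin
  ℚ.toℚᵘ (ℕ→ℚ a)  ≃⟨ ℚ.toℚᵘ-fromℚᵘ (ℚᵘ.mkℚᵘ (ℤ.+ a) 0) ⟩
  ℚᵘ.mkℚᵘ (ℤ.+ a) 0 ≤⟨ ℚᵘ.*≤* (ℤ.*-monoʳ-≤-nonNeg (ℤ.+ 1) (ℤ.+≤+ a≤b)) ⟩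
  ℚᵘ.mkℚᵘ (ℤ.+ b) 0 ≃⟨ ℚ.toℚᵘ-fromℚᵘ (ℚᵘ.mkℚᵘ (ℤ.+ b) 0) ⟨
  ℚ.toℚᵘ (ℕ→ℚ b)  ∎)
  where open ℚᵘ.≤-Reasoning

ℕ→ℚ-*-* : ∀ a b c → ℕ→ℚ (a * b * c) ≡ ℕ→ℚ a ℚ.* ℕ→ℚ b ℚ.* ℕ→ℚ c
ℕ→ℚ-*-* a b c = trans (ℕ→ℚ-* (a * b) c) (cong (ℚ._* ℕ→ℚ c) (ℕ→ℚ-* a b))

-- Multiplication by c² cancels k². With c and k as variables, the arithmetic of the concrete
-- fraction is confined to the equation c k = 1.
scaled-lower : ∀ c k .{{_ : ℚ.NonNegative (c ℚ.* c)}} → c ℚ.* ℕ→ℚ k ≡ 1ℚ → ∀ x n w → x * x ≤ n * (k * w * (k * w)) →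
  (c ℚ.* ℕ→ℚ x) /√ n ≤ ℕ→ℚ w
scaled-lower c k ck≡1 x n w x²≤ = begin
  c ℚ.* X ℚ.* (c ℚ.* X)                             ≡⟨ solve 2 (λ c X → c :* X :* (c :* X) := c :* c :* (X :* X)) refl c X ⟩
  c ℚ.* c ℚ.* (X ℚ.* X)                             ≡⟨ cong (c ℚ.* c ℚ.*_) (ℕ→ℚ-* x x) ⟨
  c ℚ.* c ℚ.* ℕ→ℚ (x * x)                           ≤⟨ ℚ.*-monoˡ-≤-nonNeg (c ℚ.* c) (ℕ→ℚ-mono x²≤) ⟩
  c ℚ.* c ℚ.* ℕ→ℚ (n * (k * w * (k * w)))           ≡⟨ cong (c ℚ.* c ℚ.*_) hom ⟩
  c ℚ.* c ℚ.* (N ℚ.* (K ℚ.* W ℚ.* (K ℚ.* W)))       ≡⟨ solve 4 (λ c K W N → c :* c :* (N :* (K :* W :* (K :* W))) := (c :* K :* W) :* (c :* K :* W) :* N) refl c K W N ⟩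
  (c ℚ.* K ℚ.* W) ℚ.* (c ℚ.* K ℚ.* W) ℚ.* N         ≡⟨ cong (λ z → (z ℚ.* W) ℚ.* (z ℚ.* W) ℚ.* N) ck≡1 ⟩
  (1ℚ ℚ.* W) ℚ.* (1ℚ ℚ.* W) ℚ.* N                   ≡⟨ cong (λ z → z ℚ.* z ℚ.* N) (ℚ.*-identityˡ W) ⟩
  W ℚ.* W ℚ.* N                                     ∎
  where
  open ℚ.≤-Reasoning
  open +-*-Solver using (solve; _:=_; _:*_)
  X = ℕ→ℚ x
  K = ℕ→ℚ k
  W = ℕ→ℚ w
  N = ℕ→ℚ n
  hom : ℕ→ℚ (n * (k * w * (k * w))) ≡ N ℚ.* (K ℚ.* W ℚ.* (K ℚ.* W))
  hom = trans (ℕ→ℚ-* n (k * w * (k * w))) (cong (N ℚ.*_) (trans (ℕ→ℚ-* (k * w) (k * w)) (cong (λ z → z ℚ.* z) (ℕ→ℚ-* k w))))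

scaled-upper : ∀ k x n w → n * (w * w) ≤ k * x * (k * x) → ℕ→ℚ w ≤ (ℕ→ℚ k ℚ.* ℕ→ℚ x) /√ n
scaled-upper k x n w w²≤ = begin
  ℕ→ℚ w ℚ.* ℕ→ℚ w ℚ.* ℕ→ℚ n                       ≡⟨ ℕ→ℚ-*-* w w n ⟨
  ℕ→ℚ (w * w * n)                                 ≤⟨ ℕ→ℚ-mono (≤-trans (≤-reflexive (*-comm (w * w) n)) w²≤) ⟩
  ℕ→ℚ (k * x * (k * x))                           ≡⟨ trans (ℕ→ℚ-* (k * x) (k * x)) (cong (λ z → z ℚ.* z) (ℕ→ℚ-* k x)) ⟩
  ℕ→ℚ k ℚ.* ℕ→ℚ x ℚ.* (ℕ→ℚ k ℚ.* ℕ→ℚ x)           ∎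
  where open ℚ.≤-Reasoning

theorem1p2 : ∃[ c₁ ] ∃[ c₂ ] 0ℚ ℚ.< c₁ × 0ℚ ℚ.< c₂ ×
    (∀ (t q : ℕ) → 1 ℕ.≤ t → 2 ℕ.≤ q →
    ∃[ n₀ ] ∀ (n : ℕ) → n₀ ℕ.≤ n →
    ∀ (tw : ℕ) → IsTreewidth (H t q n) tw →
    ((c₁ ℚ.* ℕ→ℚ (t ℕ.* q ℕ.^ n)) /√ n ≤ ℕ→ℚ tw) ×
    (ℕ→ℚ tw ≤ (c₂ ℚ.* ℕ→ℚ (t ℕ.* q ℕ.^ n)) /√ n))
theorem1p2 = ℤ.+ 1 ℚ./ 128 , ℕ→ℚ 28 , ℚ.positive⁻¹ (ℤ.+ 1 ℚ./ 128) , ℚ.positive⁻¹ (ℕ→ℚ 28) , bounds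
  where
  bounds : ∀ t q → 1 ≤ t → 2 ≤ q → ∃[ n₀ ] ∀ n → n₀ ≤ n → ∀ tw → IsTreewidth (H t q n) tw →
    ((ℤ.+ 1 ℚ./ 128 ℚ.* ℕ→ℚ (t * q ^ n)) /√ n ≤ ℕ→ℚ tw) × (ℕ→ℚ tw ≤ (ℕ→ℚ 28 ℚ.* ℕ→ℚ (t * q ^ n)) /√ n)
  -- The summand t² serves the case of a large bag in the lower bound, the summand 12 makes K
  -- positive in the upper bound.
  bounds t q 1≤t 2≤q = t * t + 12 , bound
    where
    bound : ∀ n → t * t + 12 ≤ n → ∀ tw → IsTreewidth (H t q n) tw →
      ((ℤ.+ 1 ℚ./ 128 ℚ.* ℕ→ℚ (t * q ^ n)) /√ n ≤ ℕ→ℚ tw) × (ℕ→ℚ tw ≤ (ℕ→ℚ 28 ℚ.* ℕ→ℚ (t * q ^ n)) /√ n)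
    bound n n₀≤n tw ((D , refl) , minimal) =
      scaled-lower (ℤ.+ 1 ℚ./ 128) 128 refl (t * q ^ n) n tw (treewidth-lower t q n 1≤t 2≤q (≤-trans (s≤s z≤n) 12≤n) t²≤n D) ,
      scaled-upper 28 (t * q ^ n) n tw
        (≤-trans (*-monoʳ-≤ n (*-mono-≤ tw≤ tw≤)) (treewidth-upper t q n 1≤t 2≤q 12≤n))
      where
      12≤n = ≤-trans (m≤n+m 12 (t * t)) n₀≤n
      t²≤n = ≤-trans (m≤m+n (t * t) 12) n₀≤n
      tw≤  = minimal (layer-decomposition t q n)
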